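{- Let $G_1=(V,D_1)$ and $G_2=(V,D_2)$ be two different (i.e. $D_1\neq D_2$) simple directed graphs on the same node set $V$, neither of which is complete and both of which are transitive triangle-free. Then $G_1$ and $G_2$ have different Jacobian matroids.
   Context: A directed graph $G=(V,D)$ has a finite node set $V$ and edge set $D\subseteq V\times V$ of ordered pairs $(i,j)$, $i\neq j$. It is simple if $(i,j)$ and $(j,i)$ are never both in $D$. It is complete if every pair of distinct nodes is adjacent. $\mathrm{ch}(i)$ denotes the set of children of $i$. A transitive triangle (shielded collider) is a triple of nodes $i,j,k$ with $i\to k$, $j\to k$, and $i,j$ adjacent (either $i\to j$ or $j\to i$). A graph is transitive triangle-free if it has none. Equivalently, for all $j\in V$ and all $i\in\mathrm{ch}(j)$ we have $\mathrm{ch}(j)\cap\mathrm{ch}(i)=\emptyset$. For $G=(V,D)$ let $\Lambda$ be the $V\times V$ matrix with indeterminate entries $\lambda_{ij}$ for $(i,j)\in D$ and zeros elsewhere, and $s$ a further indeterminate. Let $\psi_G(\Lambda,s)=s(I-\Lambda)(I-\Lambda)^T=K$. The transposed Jacobian $J(\psi_G)$ has rows indexed by $\{\lambda_{kl}:(k,l)\in D\}\cup\{s\}$ and columns indexed by entries $K_{ij}$, $i\le j$. Its entry in row $\theta$, column $K_{ij}$ is $\partial K_{ij}/\partial\theta$. The Jacobian matroid of $G$ is the matroid on the columns in which a set is independent iff its columns are linearly independent over $\mathbb{R}(\lambda,s)$. -}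

module Defs where

open import Level using (0ℓ)
open import Algebra.Bundles using (CommutativeRing)
open import Algebra.Structures using (IsCommutativeRing)
import Algebra.Definitions as AlgebraicLaws
import Algebra.Properties.CommutativeMonoid.Sum as Summation
import Algebra.Properties.Ring as RingProperties
import Algebra.Solver.Ring.NaturalCoefficients.Default as SemiringSolver
open import Data.Bool.Base using (Bool; false; T)
open import Data.Bool.Properties using (T?)
open import Data.Fin.Base as Fin using (Fin; zero; suc)
import Data.Fin.Properties as Fin
open import Data.Fin.Subset using (Subset; _∉_)
open import Data.List.Base as List using (List; []; _∷_; filter; cartesianProduct; allFin)
open import Data.List.Membership.Propositional using () renaming (_∈_ to _∈ₗ_)
open import Data.List.Membership.Propositional.Properties
  using (∈-filter⁺; ∈-cartesianProduct⁺; ∈-allFin)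
open import Data.List.Relation.Unary.Any using (index)
open import Data.Nat.Base as ℕ using (ℕ; zero; suc)
import Data.Nat.Properties as ℕ
open import Data.Product.Base using (_×_; _,_; ∃-syntax; proj₁; proj₂; uncurry)
open import Data.Rational.Base as ℚ using (ℚ; 0ℚ; 1ℚ; ½)
import Data.Rational.Properties as ℚ
import Data.Rational.Solver as ℚSolver
open import Data.Sum.Base using (_⊎_)
open import Function.Base using (_∘_)
open import Function.Bundles using (_⇔_)
open import Relation.Binary.Bundles using (Setoid)
open import Relation.Binary.Structures using (IsEquivalence)
import Relation.Binary.Reasoning.Setoid as SetoidReasoning
open import Relation.Binary.PropositionalEquality.Core as ≡ using (_≡_; _≢_)
open import Relation.Nullary using (¬_; Dec; yes; no)
open import Relation.Nullary.Negation using (contradiction)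

-- Stability of equality under double negation is vacuous
-- classically; it holds for all rings used below.

record IntegralDomain : Set₁ where
  field
    commutativeRing : CommutativeRing 0ℓ 0ℓ
  open CommutativeRing commutativeRing public
  open AlgebraicLaws _≈_ using (AlmostLeftCancellative)
  field
    1≉0      : ¬ 1# ≈ 0#
    ≈-stable : ∀ x y → ¬ ¬ x ≈ y → x ≈ y
    *-cancel : AlmostLeftCancellative 0# _*_

  *-≉0 : ∀ {x y} → ¬ x ≈ 0# → ¬ y ≈ 0# → ¬ x * y ≈ 0#
  *-≉0 {x} {y} x≉0 y≉0 xy≈0 = y≉0 (*-cancel x y 0# x≉0 (trans xy≈0 (sym (zeroʳ x))))

noZeroDivisors⇒domain : (C : CommutativeRing 0ℓ 0ℓ) → let open CommutativeRing C in
  ¬ 1# ≈ 0# → (∀ x y → ¬ ¬ x ≈ y → x ≈ y) →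
  (∀ {x y} → ¬ x ≈ 0# → ¬ y ≈ 0# → ¬ x * y ≈ 0#) → IntegralDomain
noZeroDivisors⇒domain C 1≉0 stable *-≉0 = record
  { commutativeRing = C
  ; 1≉0 = 1≉0
  ; ≈-stable = stable
  ; *-cancel = λ x y z x≉0 xy≈xz → stable y z λ y≉z →
      *-≉0 x≉0 (λ y-z≈0 → y≉z (x∙y⁻¹≈ε⇒x≈y y z y-z≈0))
        (trans (x[y-z]≈xy-xz x y z) (x≈y⇒x∙y⁻¹≈ε xy≈xz))
  }
  where
  open CommutativeRing C
  open RingProperties ring using (x[y-z]≈xy-xz; x∙y⁻¹≈ε⇒x≈y; x≈y⇒x∙y⁻¹≈ε)

-- The real numbers: Cauchy sequences of rationals modulo null sequences

module Real where
  open ℚSolver.+-*-Solver using (solve; _:+_; _:*_; _:-_; :-_; _:=_; con)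

  -- z vanishes along the tails T N of its index type as N → ∞.
  record Vanishing {I : Set} (T : ℕ → I → Set) (z : I → ℚ) : Set where
    constructor vanishes
    field small : ∀ ε → 0ℚ ℚ.< ε → ∃[ N ] (∀ i → T N i → ℚ.∣ z i ∣ ℚ.< ε)
  open Vanishing public

  Pairs≥ : ℕ → ℕ × ℕ → Set
  Pairs≥ N (m , n) = N ℕ.≤ m × N ℕ.≤ n

  Null : (ℕ → ℚ) → Set
  Null = Vanishing ℕ._≤_

  Cauchy : (ℕ → ℚ) → Set
  Cauchy x = Vanishing Pairs≥ λ (m , n) → x m ℚ.- x n

  record ℝ : Set where
    constructor _,_
    field
      seq    : ℕ → ℚ
      cauchy : Cauchy seq
  open ℝ public

  infix 4 _≈_
  record _≈_ (x y : ℝ) : Set where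
    constructor [_]
    field null : Null λ n → seq x n ℚ.- seq y n
  open _≈_ public

  private
    half-pos : ∀ {ε} → 0ℚ ℚ.< ε → 0ℚ ℚ.< ½ ℚ.* ε
    half-pos {ε} 0<ε = ℚ.positive⁻¹ (½ ℚ.* ε) {{ℚ.pos*pos⇒pos ½ ε {{ℚ.positive 0<ε}}}}

    halves : ∀ ε → ½ ℚ.* ε ℚ.+ ½ ℚ.* ε ≡ ε
    halves ε = ≡.trans (≡.sym (ℚ.*-distribʳ-+ ε ½ ½)) (ℚ.*-identityˡ ε)

    Bounded : {I : Set} → (ℕ → I → Set) → (I → ℚ) → Set
    Bounded T b = ∃[ B ] 0ℚ ℚ.< B × ∃[ N ] (∀ i → T N i → ℚ.∣ b i ∣ ℚ.≤ B)

    module _ {I : Set} {T : ℕ → I → Set} where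

      vanishing-cong : ∀ {y z : I → ℚ} → (∀ i → y i ≡ z i) → Vanishing T y → Vanishing T z
      vanishing-cong y≡z v .small ε 0<ε with v .small ε 0<ε
      ... | N , lt = N , λ i t → ≡.subst (λ q → ℚ.∣ q ∣ ℚ.< ε) (y≡z i) (lt i t)

      vanishing-0 : Vanishing T λ _ → 0ℚ
      vanishing-0 .small ε 0<ε = 0 , λ _ _ → 0<ε

      vanishing-neg : ∀ {z : I → ℚ} → Vanishing T z → Vanishing T λ i → ℚ.- z i
      vanishing-neg {z} v .small ε 0<ε with v .small ε 0<ε
      ... | N , lt = N , λ i t → ≡.subst (ℚ._< ε) (≡.sym (ℚ.∣-p∣≡∣p∣ (z i))) (lt i t)

      module _ (mono : ∀ {M N} → M ℕ.≤ N → ∀ {i} → T N i → T M i) where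

        vanishing-+ : ∀ {y z : I → ℚ} → Vanishing T y → Vanishing T z →
                      Vanishing T λ i → y i ℚ.+ z i
        vanishing-+ {y} {z} v w .small ε 0<ε
          with v .small (½ ℚ.* ε) (half-pos 0<ε) | w .small (½ ℚ.* ε) (half-pos 0<ε)
        ... | M , p | N , q = M ℕ.⊔ N , λ i t →
          ℚ.≤-<-trans (ℚ.∣p+q∣≤∣p∣+∣q∣ (y i) (z i))
            (≡.subst (_ ℚ.<_) (halves ε)
              (ℚ.+-mono-< (p i (mono (ℕ.m≤m⊔n M N) t)) (q i (mono (ℕ.m≤n⊔m M N) t))))

        vanishing-* : ∀ (b : I → ℚ) {z : I → ℚ} → Bounded T b →
                      Vanishing T z → Vanishing T λ i → b i ℚ.* z i
        vanishing-* b {z} (B , 0<B , M , b≤B) v .small ε 0<ε = bound (v .small δ 0<δ)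
          where
          instance
            B-pos = ℚ.positive 0<B
            B-nonZero = ℚ.pos⇒nonZero B
            B-nonNeg = ℚ.pos⇒nonNeg B
          δ = (ℚ.1/ B) ℚ.* ε
          0<δ = ℚ.positive⁻¹ δ {{ℚ.pos*pos⇒pos (ℚ.1/ B) {{ℚ.1/pos⇒pos B}} ε {{ℚ.positive 0<ε}}}}
          Bδ≡ε : B ℚ.* δ ≡ ε
          Bδ≡ε = ≡.trans (≡.sym (ℚ.*-assoc B (ℚ.1/ B) ε))
            (≡.trans (≡.cong (ℚ._* ε) (ℚ.*-inverseʳ B)) (ℚ.*-identityˡ ε))
          bound : ∃[ N ] (∀ i → T N i → ℚ.∣ z i ∣ ℚ.< δ) →
                  ∃[ N ] (∀ i → T N i → ℚ.∣ b i ℚ.* z i ∣ ℚ.< ε)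
          bound (N , lt) = M ℕ.⊔ N , λ i t →
            ≡.subst (ℚ._< ε) (≡.sym (ℚ.∣p*q∣≡∣p∣*∣q∣ (b i) (z i)))
              (ℚ.≤-<-trans
                (ℚ.*-monoʳ-≤-nonNeg ℚ.∣ z i ∣ {{ℚ.∣-∣-nonNeg (z i)}} (b≤B i (mono (ℕ.m≤m⊔n M N) t)))
                (≡.subst (B ℚ.* ℚ.∣ z i ∣ ℚ.<_) Bδ≡ε
                  (ℚ.*-monoʳ-<-pos B (lt i (mono (ℕ.m≤n⊔m M N) t)))))

    mono₁ : ∀ {M N} → M ℕ.≤ N → ∀ {n} → N ℕ.≤ n → M ℕ.≤ n
    mono₁ M≤N N≤n = ℕ.≤-trans M≤N N≤n

    mono₂ : ∀ {M N} → M ℕ.≤ N → ∀ {i} → Pairs≥ N i → Pairs≥ M i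
    mono₂ M≤N (p , q) = ℕ.≤-trans M≤N p , ℕ.≤-trans M≤N q

    bounded : ∀ x → Cauchy x → Bounded ℕ._≤_ x
    bounded x c with c .small 1ℚ (ℚ.positive⁻¹ 1ℚ)
    ... | N , lt = ℚ.∣ x N ∣ ℚ.+ 1ℚ , 0<B , N , λ n N≤n → begin
        ℚ.∣ x n ∣                            ≡⟨ ≡.cong ℚ.∣_∣ (split (x n) (x N)) ⟩
        ℚ.∣ x N ℚ.+ (x n ℚ.- x N) ∣          ≤⟨ ℚ.∣p+q∣≤∣p∣+∣q∣ (x N) (x n ℚ.- x N) ⟩
        ℚ.∣ x N ∣ ℚ.+ ℚ.∣ x n ℚ.- x N ∣      ≤⟨ ℚ.+-monoʳ-≤ ℚ.∣ x N ∣ (ℚ.<⇒≤ (lt (n , N) (N≤n , ℕ.≤-refl))) ⟩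
        ℚ.∣ x N ∣ ℚ.+ 1ℚ                     ∎
      where
      open ℚ.≤-Reasoning
      split : ∀ a b → a ≡ b ℚ.+ (a ℚ.- b)
      split = solve 2 (λ a b → a := b :+ (a :- b)) ≡.refl
      0<B : 0ℚ ℚ.< ℚ.∣ x N ∣ ℚ.+ 1ℚ
      0<B = ℚ.+-mono-≤-< (ℚ.0≤∣p∣ (x N)) (ℚ.positive⁻¹ 1ℚ)

    cauchy-minus : ∀ x y → Cauchy x → Cauchy y → Cauchy (λ n → x n ℚ.- y n)
    cauchy-minus x y c d =
      vanishing-cong (λ (m , n) → rearrange (x m) (x n) (y m) (y n))
        (vanishing-+ mono₂ c (vanishing-neg d))
      where
      rearrange : ∀ a b c d → (a ℚ.- b) ℚ.+ ℚ.- (c ℚ.- d) ≡ (a ℚ.- c) ℚ.- (b ℚ.- d)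
      rearrange = solve 4 (λ a b c d → (a :- b) :+ :- (c :- d) := (a :- c) :- (b :- d)) ≡.refl

    product-diff : ∀ a b c d → a ℚ.* (b ℚ.- d) ℚ.+ d ℚ.* (a ℚ.- c) ≡ a ℚ.* b ℚ.- c ℚ.* d
    product-diff = solve 4 (λ a b c d → a :* (b :- d) :+ d :* (a :- c) := a :* b :- c :* d) ≡.refl

    sum-diff : ∀ a b c d → (a ℚ.- c) ℚ.+ (b ℚ.- d) ≡ (a ℚ.+ b) ℚ.- (c ℚ.+ d)
    sum-diff = solve 4 (λ a b c d → (a :- c) :+ (b :- d) := (a :+ b) :- (c :+ d)) ≡.refl

    neg-diff : ∀ a b → ℚ.- (a ℚ.- b) ≡ (ℚ.- a) ℚ.- (ℚ.- b)
    neg-diff = solve 2 (λ a b → :- (a :- b) := (:- a) :- (:- b)) ≡.refl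

  infixl 7 _*_
  infixl 6 _+_
  infix  8 -_

  fromℚ : ℚ → ℝ
  fromℚ q = (λ _ → q) , vanishing-cong (λ _ → ≡.sym (ℚ.+-inverseʳ q)) vanishing-0

  _+_ : ℝ → ℝ → ℝ
  (x , c) + (y , d) = (λ n → x n ℚ.+ y n) ,
    vanishing-cong (λ (m , n) → sum-diff (x m) (y m) (x n) (y n)) (vanishing-+ mono₂ c d)

  -_ : ℝ → ℝ
  - (x , c) = (λ n → ℚ.- x n) ,
    vanishing-cong (λ (m , n) → neg-diff (x m) (x n)) (vanishing-neg c)

  _*_ : ℝ → ℝ → ℝ
  (x , c) * (y , d) = (λ n → x n ℚ.* y n) ,
    vanishing-cong (λ (m , n) → product-diff (x m) (y m) (x n) (y n))
      (vanishing-+ mono₂ (vanishing-* mono₂ (x ∘ proj₁) (fst (bounded x c)) d)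
                         (vanishing-* mono₂ (y ∘ proj₂) (snd (bounded y d)) c))
    where
    fst : Bounded ℕ._≤_ x → Bounded Pairs≥ (x ∘ proj₁)
    fst (B , p , N , q) = B , p , N , λ (m , n) (r , _) → q m r
    snd : Bounded ℕ._≤_ y → Bounded Pairs≥ (y ∘ proj₂)
    snd (B , p , N , q) = B , p , N , λ (m , n) (_ , r) → q n r

  private
    pointwise : ∀ {x y} → (∀ n → seq x n ≡ seq y n) → x ≈ y
    pointwise {x} {y} x≡y = [ vanishing-cong
      (λ n → ≡.sym (≡.trans (≡.cong (ℚ._- seq y n) (x≡y n)) (ℚ.+-inverseʳ (seq y n)))) vanishing-0 ]

    ≈-isEquivalence : IsEquivalence _≈_
    ≈-isEquivalence = record
      { refl  = pointwise (λ _ → ≡.refl)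
      ; sym   = λ {x} {y} ([ p ]) → [ vanishing-cong (λ n → flip (seq x n) (seq y n)) (vanishing-neg p) ]
      ; trans = λ {x} {y} {z} ([ p ]) ([ q ]) →
                  [ vanishing-cong (λ n → chain (seq x n) (seq y n) (seq z n)) (vanishing-+ mono₁ p q) ]
      }
      where
      flip : ∀ a b → ℚ.- (a ℚ.- b) ≡ b ℚ.- a
      flip = solve 2 (λ a b → :- (a :- b) := b :- a) ≡.refl
      chain : ∀ a b c → (a ℚ.- b) ℚ.+ (b ℚ.- c) ≡ a ℚ.- c
      chain = solve 3 (λ a b c → (a :- b) :+ (b :- c) := a :- c) ≡.refl

    isCommutativeRing : IsCommutativeRing _≈_ _+_ _*_ -_ (fromℚ 0ℚ) (fromℚ 1ℚ)
    isCommutativeRing = record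
      { isRing = record
        { +-isAbelianGroup = record
          { isGroup = record
            { isMonoid = record
              { isSemigroup = record
                { isMagma = record
                  { isEquivalence = ≈-isEquivalence
                  ; ∙-cong = λ {x} {x′} {y} {y′} ([ p ]) ([ q ]) →
                      [ vanishing-cong (λ n → sum-diff (seq x n) (seq y n) (seq x′ n) (seq y′ n))
                          (vanishing-+ mono₁ p q) ]
                  }
                ; assoc = λ x y z → pointwise λ n → ℚ.+-assoc (seq x n) (seq y n) (seq z n)
                }
              ; identity = (λ x → pointwise λ n → ℚ.+-identityˡ (seq x n))
                         , (λ x → pointwise λ n → ℚ.+-identityʳ (seq x n))
              }
            ; inverse = (λ x → pointwise λ n → ℚ.+-inverseˡ (seq x n))
                      , (λ x → pointwise λ n → ℚ.+-inverseʳ (seq x n))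
            ; ⁻¹-cong = λ {x} {y} ([ p ]) →
                [ vanishing-cong (λ n → neg-diff (seq x n) (seq y n)) (vanishing-neg p) ]
            }
          ; comm = λ x y → pointwise λ n → ℚ.+-comm (seq x n) (seq y n)
          }
        ; *-cong = λ {x} {x′} {y} {y′} ([ p ]) ([ q ]) →
            [ vanishing-cong (λ n → product-diff (seq x n) (seq y n) (seq x′ n) (seq y′ n))
                (vanishing-+ mono₁ (vanishing-* mono₁ (seq x) (bounded (seq x) (cauchy x)) q)
                                   (vanishing-* mono₁ (seq y′) (bounded (seq y′) (cauchy y′)) p)) ]
        ; *-assoc = λ x y z → pointwise λ n → ℚ.*-assoc (seq x n) (seq y n) (seq z n)
        ; *-identity = (λ x → pointwise λ n → ℚ.*-identityˡ (seq x n))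
                     , (λ x → pointwise λ n → ℚ.*-identityʳ (seq x n))
        ; distrib = (λ x y z → pointwise λ n → ℚ.*-distribˡ-+ (seq x n) (seq y n) (seq z n))
                  , (λ x y z → pointwise λ n → ℚ.*-distribʳ-+ (seq x n) (seq y n) (seq z n))
        }
      ; *-comm = λ x y → pointwise λ n → ℚ.*-comm (seq x n) (seq y n)
      }

    Away : (ℕ → ℚ) → Set
    Away z = ∃[ ε ] 0ℚ ℚ.< ε × ∃[ N ] (∀ n → N ℕ.≤ n → ε ℚ.≤ ℚ.∣ z n ∣)

    ¬away⇒null : ∀ z → Cauchy z → ¬ Away z → Null z
    ¬away⇒null z c ¬away .small ε 0<ε with c .small (½ ℚ.* ε) (half-pos 0<ε)
    ... | N , close = N , λ n N≤n → near n N≤n (ℚ.∣ z n ∣ ℚ.<? ε)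
      where
      split : ∀ a b → a ≡ b ℚ.+ (a ℚ.- b)
      split = solve 2 (λ a b → a := b :+ (a :- b)) ≡.refl
      far : ∀ n → N ℕ.≤ n → ε ℚ.≤ ℚ.∣ z n ∣ → ∀ m → N ℕ.≤ m → ½ ℚ.* ε ℚ.≤ ℚ.∣ z m ∣
      far n N≤n ε≤z m N≤m = ℚ.≮⇒≥ λ z<½ε → ℚ.<-irrefl ≡.refl (begin-strict
          ε                                ≤⟨ ε≤z ⟩
          ℚ.∣ z n ∣                        ≡⟨ ≡.cong ℚ.∣_∣ (split (z n) (z m)) ⟩
          ℚ.∣ z m ℚ.+ (z n ℚ.- z m) ∣      ≤⟨ ℚ.∣p+q∣≤∣p∣+∣q∣ (z m) (z n ℚ.- z m) ⟩
          ℚ.∣ z m ∣ ℚ.+ ℚ.∣ z n ℚ.- z m ∣  <⟨ ℚ.+-mono-< z<½ε (close (n , m) (N≤n , N≤m)) ⟩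
          ½ ℚ.* ε ℚ.+ ½ ℚ.* ε              ≡⟨ halves ε ⟩
          ε                                ∎)
        where open ℚ.≤-Reasoning
      near : ∀ n → N ℕ.≤ n → Dec (ℚ.∣ z n ∣ ℚ.< ε) → ℚ.∣ z n ∣ ℚ.< ε
      near n N≤n (yes z<ε) = z<ε
      near n N≤n (no  z≮ε) =
        contradiction (½ ℚ.* ε , half-pos 0<ε , N , far n N≤n (ℚ.≮⇒≥ z≮ε)) ¬away

    null⇒¬away : ∀ {z} → Null z → ¬ Away z
    null⇒¬away v (ε , 0<ε , N , far) with v .small ε 0<ε
    ... | M , lt = ℚ.<-irrefl ≡.refl
      (ℚ.≤-<-trans (far (M ℕ.⊔ N) (ℕ.m≤n⊔m M N)) (lt (M ℕ.⊔ N) (ℕ.m≤m⊔n M N)))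

    null-stable : ∀ z → Cauchy z → ¬ ¬ Null z → Null z
    null-stable z c ¬¬null = ¬away⇒null z c λ away → ¬¬null λ null → null⇒¬away null away

    away-cancel : ∀ x z → Away x → Null (λ n → x n ℚ.* z n) → Null z
    away-cancel x z (ε , 0<ε , M , far) v .small δ 0<δ = bound (v .small (ε ℚ.* δ) 0<εδ)
      where
      instance
        ε-pos = ℚ.positive 0<ε
        ε-nonNeg = ℚ.pos⇒nonNeg ε
      0<εδ = ℚ.positive⁻¹ (ε ℚ.* δ) {{ℚ.pos*pos⇒pos ε δ {{ℚ.positive 0<δ}}}}
      bound : ∃[ N ] (∀ n → N ℕ.≤ n → ℚ.∣ x n ℚ.* z n ∣ ℚ.< ε ℚ.* δ) →
              ∃[ N ] (∀ n → N ℕ.≤ n → ℚ.∣ z n ∣ ℚ.< δ)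
      bound (N , lt) = M ℕ.⊔ N , λ n t → ℚ.*-cancelˡ-<-nonNeg ε
        (ℚ.≤-<-trans
          (ℚ.*-monoʳ-≤-nonNeg ℚ.∣ z n ∣ {{ℚ.∣-∣-nonNeg (z n)}} (far n (ℕ.≤-trans (ℕ.m≤m⊔n M N) t)))
          (≡.subst (ℚ._< ε ℚ.* δ) (ℚ.∣p*q∣≡∣p∣*∣q∣ (x n) (z n))
            (lt n (ℕ.≤-trans (ℕ.m≤n⊔m M N) t))))

    infixl 6 _⊖_
    _⊖_ : ℝ → ℝ → ℕ → ℚ
    (x ⊖ y) n = seq x n ℚ.- seq y n

    cauchy-⊖ : ∀ x y → Cauchy (x ⊖ y)
    cauchy-⊖ x y = cauchy-minus (seq x) (seq y) (cauchy x) (cauchy y)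

  ℝ-domain : IntegralDomain
  ℝ-domain = record
    { commutativeRing = record { isCommutativeRing = isCommutativeRing }
    ; 1≉0 = λ ([ p ]) → null⇒¬away p (1ℚ , ℚ.positive⁻¹ 1ℚ , 0 , λ _ _ → ℚ.≤-refl)
    ; ≈-stable = λ x y ¬¬p →
        [ null-stable (x ⊖ y) (cauchy-⊖ x y) (λ ¬p → ¬¬p λ ([ p ]) → ¬p p) ]
    ; *-cancel = λ x y z x≉0 ([ p ]) → [ null-stable (y ⊖ z) (cauchy-⊖ y z) (λ ¬null →
        x≉0 [ vanishing-cong (λ n → ≡.sym (ℚ.+-identityʳ (seq x n)))
          (¬away⇒null (seq x) (cauchy x) λ away →
            ¬null (away-cancel (seq x) (y ⊖ z) away (vanishing-cong
              (λ n → factor (seq x n) (seq y n) (seq z n)) p))) ]) ]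
    }
    where
    factor : ∀ a b c → a ℚ.* b ℚ.- a ℚ.* c ≡ a ℚ.* (b ℚ.- c)
    factor = solve 3 (λ a b c → a :* b :- a :* c := a :* (b :- c)) ≡.refl

-- Polynomials are lists of coefficients in ascending degree; trailing zeros
-- are identified away by the equality.

module Polynomial (R : IntegralDomain) where
  private
    module R = IntegralDomain R
    open RingProperties R.ring using (-0#≈0#)

  Poly : Set
  Poly = List R.Carrier

  coeff : Poly → ℕ → R.Carrier
  coeff []      _       = R.0#
  coeff (a ∷ p) zero    = a
  coeff (a ∷ p) (suc n) = coeff p n

  infix 4 _≈_
  record _≈_ (p q : Poly) : Set where
    constructor [_]
    field at : ∀ n → coeff p n R.≈ coeff q n
  open _≈_ public

  infixl 6 _+_
  infixl 7 _*_ _·_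
  infix  8 -_

  _+_ : Poly → Poly → Poly
  []      + q       = q
  (a ∷ p) + []      = a ∷ p
  (a ∷ p) + (b ∷ q) = a R.+ b ∷ p + q

  -_ : Poly → Poly
  - p = List.map (λ a → R.- a) p

  _·_ : R.Carrier → Poly → Poly
  a · p = List.map (a R.*_) p

  _*_ : Poly → Poly → Poly
  []      * q = []
  (a ∷ p) * q = a · q + (R.0# ∷ p * q)

  const : R.Carrier → Poly
  const a = a ∷ []

  X : Poly
  X = R.0# ∷ R.1# ∷ []

  -- The Leibniz rule: (a + X p)′ = p + X p′.
  derivative : Poly → Poly
  derivative []      = []
  derivative (a ∷ p) = p + (R.0# ∷ derivative p)

  coeff-+ : ∀ p q n → coeff (p + q) n R.≈ coeff p n R.+ coeff q n
  coeff-+ []      q       n       = R.sym (R.+-identityˡ _)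
  coeff-+ (a ∷ p) []      n       = R.sym (R.+-identityʳ _)
  coeff-+ (a ∷ p) (b ∷ q) zero    = R.refl
  coeff-+ (a ∷ p) (b ∷ q) (suc n) = coeff-+ p q n

  coeff-neg : ∀ p n → coeff (- p) n R.≈ R.- coeff p n
  coeff-neg []      n       = R.sym -0#≈0#
  coeff-neg (a ∷ p) zero    = R.refl
  coeff-neg (a ∷ p) (suc n) = coeff-neg p n

  coeff-· : ∀ a p n → coeff (a · p) n R.≈ a R.* coeff p n
  coeff-· a []      n       = R.sym (R.zeroʳ a)
  coeff-· a (b ∷ p) zero    = R.refl
  coeff-· a (b ∷ p) (suc n) = coeff-· a p n

  coeff-*-zero : ∀ a p q → coeff ((a ∷ p) * q) 0 R.≈ a R.* coeff q 0
  coeff-*-zero a p q = R.trans (coeff-+ (a · q) (R.0# ∷ p * q) 0)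
    (R.trans (R.+-identityʳ _) (coeff-· a q 0))

  coeff-*-suc : ∀ a p q n →
    coeff ((a ∷ p) * q) (suc n) R.≈ a R.* coeff q (suc n) R.+ coeff (p * q) n
  coeff-*-suc a p q n = R.trans (coeff-+ (a · q) (R.0# ∷ p * q) (suc n))
    (R.+-congʳ (coeff-· a q (suc n)))

  private
    isEquivalence : IsEquivalence _≈_
    isEquivalence = record
      { refl  = [ (λ _ → R.refl) ]
      ; sym   = λ ([ e ]) → [ (λ n → R.sym (e n)) ]
      ; trans = λ ([ e ]) ([ f ]) → [ (λ n → R.trans (e n) (f n)) ]
      }
    open IsEquivalence isEquivalence

    setoid : Setoid 0ℓ 0ℓ
    setoid = record { isEquivalence = isEquivalence }

    pointwise₂ : ∀ p q r s →
      (∀ n → coeff p n R.+ coeff q n R.≈ coeff r n R.+ coeff s n) → p + q ≈ r + s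
    pointwise₂ p q r s e = [ (λ n → R.trans (coeff-+ p q n) (R.trans (e n) (R.sym (coeff-+ r s n)))) ]

    +-cong : ∀ {p p′ q q′} → p ≈ p′ → q ≈ q′ → p + q ≈ p′ + q′
    +-cong {p} {p′} {q} {q′} ([ e ]) ([ f ]) = pointwise₂ p q p′ q′ λ n → R.+-cong (e n) (f n)

    +-comm : ∀ p q → p + q ≈ q + p
    +-comm p q = pointwise₂ p q q p λ n → R.+-comm (coeff p n) (coeff q n)

    +-assoc : ∀ p q r → (p + q) + r ≈ p + (q + r)
    +-assoc p q r = pointwise₂ (p + q) r p (q + r) λ n →
      R.trans (R.+-congʳ (coeff-+ p q n)) (R.trans (R.+-assoc _ _ _) (R.+-congˡ (R.sym (coeff-+ q r n))))

    +-identityˡ : ∀ p → [] + p ≈ p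
    +-identityˡ p = refl

    +-identityʳ : ∀ p → p + [] ≈ p
    +-identityʳ p = trans (+-comm p []) refl

    +-inverseʳ : ∀ p → p + - p ≈ []
    +-inverseʳ p = [ (λ n → R.trans (coeff-+ p (- p) n)
      (R.trans (R.+-congˡ (coeff-neg p n)) (R.-‿inverseʳ _))) ]

    neg-cong : ∀ {p q} → p ≈ q → - p ≈ - q
    neg-cong {p} {q} ([ e ]) = [ (λ n →
      R.trans (coeff-neg p n) (R.trans (R.-‿cong (e n)) (R.sym (coeff-neg q n)))) ]

    interchange : ∀ p q r s → (p + q) + (r + s) ≈ (p + r) + (q + s)
    interchange p q r s = begin
      (p + q) + (r + s)  ≈⟨ +-assoc p q (r + s) ⟩
      p + (q + (r + s))  ≈⟨ +-cong (refl {p}) (sym (+-assoc q r s)) ⟩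
      p + ((q + r) + s)  ≈⟨ +-cong (refl {p}) (+-cong (+-comm q r) (refl {s})) ⟩
      p + ((r + q) + s)  ≈⟨ +-cong (refl {p}) (+-assoc r q s) ⟩
      p + (r + (q + s))  ≈⟨ sym (+-assoc p r (q + s)) ⟩
      (p + r) + (q + s)  ∎
      where open SetoidReasoning setoid

    shift-cong : ∀ {p q} → p ≈ q → R.0# ∷ p ≈ R.0# ∷ q
    shift-cong ([ e ]) = [ (λ { zero → R.refl ; (suc n) → e n }) ]

    shift-+ : ∀ p q → R.0# ∷ (p + q) ≈ (R.0# ∷ p) + (R.0# ∷ q)
    shift-+ p q = [ (λ { zero → R.sym (R.+-identityʳ _) ; (suc n) → R.refl }) ]

    shift-[] : R.0# ∷ [] ≈ []
    shift-[] = [ (λ { zero → R.refl ; (suc n) → R.refl }) ]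

    ·-cong : ∀ {a b p q} → a R.≈ b → p ≈ q → a · p ≈ b · q
    ·-cong {a} {b} {p} {q} e ([ f ]) = [ (λ n →
      R.trans (coeff-· a p n) (R.trans (R.*-cong e (f n)) (R.sym (coeff-· b q n)))) ]

    ·-+ : ∀ a p q → a · (p + q) ≈ a · p + a · q
    ·-+ a p q = [ (λ n → R.trans (coeff-· a (p + q) n) (R.trans (R.*-congˡ (coeff-+ p q n))
      (R.trans (R.distribˡ a _ _) (R.sym (R.trans (coeff-+ (a · p) (a · q) n)
        (R.+-cong (coeff-· a p n) (coeff-· a q n))))))) ]

    +-· : ∀ a b p → (a R.+ b) · p ≈ a · p + b · p
    +-· a b p = [ (λ n → R.trans (coeff-· (a R.+ b) p n)
      (R.trans (R.distribʳ _ a b) (R.sym (R.trans (coeff-+ (a · p) (b · p) n)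
        (R.+-cong (coeff-· a p n) (coeff-· b p n)))))) ]

    ·-· : ∀ a b p → (a R.* b) · p ≈ a · (b · p)
    ·-· a b p = [ (λ n → R.trans (coeff-· (a R.* b) p n) (R.trans (R.*-assoc a b _)
      (R.sym (R.trans (coeff-· a (b · p) n) (R.*-congˡ (coeff-· b p n)))))) ]

    ·-shift : ∀ a p → a · (R.0# ∷ p) ≈ R.0# ∷ a · p
    ·-shift a p = [ (λ { zero → R.zeroʳ a ; (suc n) → R.refl }) ]

    0-· : ∀ p → R.0# · p ≈ []
    0-· p = [ (λ n → R.trans (coeff-· R.0# p n) (R.zeroˡ _)) ]

    ·-* : ∀ a p q → (a · p) * q ≈ a · (p * q)
    ·-* a []      q = refl
    ·-* a (b ∷ p) q = begin
      (a R.* b) · q + (R.0# ∷ (a · p) * q)    ≈⟨ +-cong (·-· a b q) (shift-cong (·-* a p q)) ⟩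
      a · (b · q) + (R.0# ∷ a · (p * q))      ≈⟨ +-cong refl (sym (·-shift a (p * q))) ⟩
      a · (b · q) + a · (R.0# ∷ p * q)        ≈⟨ sym (·-+ a (b · q) (R.0# ∷ p * q)) ⟩
      a · (b · q + (R.0# ∷ p * q))            ∎
      where open SetoidReasoning setoid

    shift-* : ∀ p q → (R.0# ∷ p) * q ≈ R.0# ∷ p * q
    shift-* p q = +-cong (0-· q) refl

    head≈ : ∀ {a b p q} → a ∷ p ≈ b ∷ q → a R.≈ b
    head≈ ([ e ]) = e 0

    tail≈ : ∀ {a b p q} → a ∷ p ≈ b ∷ q → p ≈ q
    tail≈ ([ e ]) = [ (λ n → e (suc n)) ]

    []-* : ∀ p q → p ≈ [] → p * q ≈ []
    []-* []      q e       = refl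
    []-* (a ∷ p) q ([ e ]) = begin
      a · q + (R.0# ∷ p * q)   ≈⟨ +-cong (·-cong {q = q} (e 0) refl) (shift-cong ([]-* p q [ (λ n → e (suc n)) ])) ⟩
      R.0# · q + (R.0# ∷ [])   ≈⟨ +-cong (0-· q) shift-[] ⟩
      []                       ∎
      where open SetoidReasoning setoid

    *-congʳ : ∀ p p′ q → p ≈ p′ → p * q ≈ p′ * q
    *-congʳ []      p′       q e = sym ([]-* p′ q (sym e))
    *-congʳ (a ∷ p) []       q e = []-* (a ∷ p) q e
    *-congʳ (a ∷ p) (b ∷ p′) q e =
      +-cong (·-cong {q = q} (head≈ e) refl) (shift-cong (*-congʳ p p′ q (tail≈ e)))

    *-zeroʳ : ∀ p → p * [] ≈ []
    *-zeroʳ []      = refl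
    *-zeroʳ (a ∷ p) = trans (shift-cong (*-zeroʳ p)) shift-[]

    *-∷ : ∀ p b q → p * (b ∷ q) ≈ b · p + (R.0# ∷ p * q)
    *-∷ []      b q = sym shift-[]
    *-∷ (a ∷ p) b q = [ (λ
      { zero → R.+-congʳ (R.*-comm a b)
      ; (suc n) → begin
          coeff (a · q + p * (b ∷ q)) n
            ≈⟨ coeff-+ (a · q) (p * (b ∷ q)) n ⟩
          coeff (a · q) n R.+ coeff (p * (b ∷ q)) n
            ≈⟨ R.+-congˡ (R.trans (at (*-∷ p b q) n) (coeff-+ (b · p) (R.0# ∷ p * q) n)) ⟩
          coeff (a · q) n R.+ (coeff (b · p) n R.+ coeff (R.0# ∷ p * q) n)
            ≈⟨ R.sym (R.+-assoc _ _ _) ⟩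
          (coeff (a · q) n R.+ coeff (b · p) n) R.+ coeff (R.0# ∷ p * q) n
            ≈⟨ R.+-congʳ (R.+-comm _ _) ⟩
          (coeff (b · p) n R.+ coeff (a · q) n) R.+ coeff (R.0# ∷ p * q) n
            ≈⟨ R.+-assoc _ _ _ ⟩
          coeff (b · p) n R.+ (coeff (a · q) n R.+ coeff (R.0# ∷ p * q) n)
            ≈⟨ R.+-congˡ (R.sym (coeff-+ (a · q) (R.0# ∷ p * q) n)) ⟩
          coeff (b · p) n R.+ coeff ((a ∷ p) * q) n
            ≈⟨ R.sym (coeff-+ (b · p) ((a ∷ p) * q) n) ⟩
          coeff (b · p + (a ∷ p) * q) n ∎ }) ]
      where open SetoidReasoning R.setoid

    *-comm : ∀ p q → p * q ≈ q * p
    *-comm []      q = sym (*-zeroʳ q)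
    *-comm (a ∷ p) q = trans (+-cong refl (shift-cong (*-comm p q))) (sym (*-∷ q a p))

    *-cong : ∀ {p p′ q q′} → p ≈ p′ → q ≈ q′ → p * q ≈ p′ * q′
    *-cong {p} {p′} {q} {q′} e f = begin
      p * q    ≈⟨ *-congʳ p p′ q e ⟩
      p′ * q   ≈⟨ *-comm p′ q ⟩
      q * p′   ≈⟨ *-congʳ q q′ p′ f ⟩
      q′ * p′  ≈⟨ *-comm q′ p′ ⟩
      p′ * q′  ∎
      where open SetoidReasoning setoid

    *-distribʳ : ∀ r p q → (p + q) * r ≈ p * r + q * r
    *-distribʳ r []      q       = refl
    *-distribʳ r (a ∷ p) []      = sym (+-identityʳ _)
    *-distribʳ r (a ∷ p) (b ∷ q) = begin
      (a R.+ b) · r + (R.0# ∷ (p + q) * r)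
        ≈⟨ +-cong (+-· a b r) (trans (shift-cong (*-distribʳ r p q)) (shift-+ (p * r) (q * r))) ⟩
      (a · r + b · r) + ((R.0# ∷ p * r) + (R.0# ∷ q * r))
        ≈⟨ interchange (a · r) (b · r) _ _ ⟩
      (a · r + (R.0# ∷ p * r)) + (b · r + (R.0# ∷ q * r)) ∎
      where open SetoidReasoning setoid

    *-assoc : ∀ p q r → (p * q) * r ≈ p * (q * r)
    *-assoc []      q r = refl
    *-assoc (a ∷ p) q r = begin
      (a · q + (R.0# ∷ p * q)) * r        ≈⟨ *-distribʳ r (a · q) (R.0# ∷ p * q) ⟩
      (a · q) * r + (R.0# ∷ p * q) * r    ≈⟨ +-cong (·-* a q r) (shift-* (p * q) r) ⟩
      a · (q * r) + (R.0# ∷ (p * q) * r)  ≈⟨ +-cong refl (shift-cong (*-assoc p q r)) ⟩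
      a · (q * r) + (R.0# ∷ p * (q * r))  ∎
      where open SetoidReasoning setoid

    *-identityˡ : ∀ p → const R.1# * p ≈ p
    *-identityˡ p = begin
      R.1# · p + (R.0# ∷ [])  ≈⟨ +-cong [ (λ n → R.trans (coeff-· R.1# p n) (R.*-identityˡ _)) ] shift-[] ⟩
      p + []                  ≈⟨ +-identityʳ p ⟩
      p                       ∎
      where open SetoidReasoning setoid

    isCommutativeRing : IsCommutativeRing _≈_ _+_ _*_ -_ [] (const R.1#)
    isCommutativeRing = record
      { isRing = record
        { +-isAbelianGroup = record
          { isGroup = record
            { isMonoid = record
              { isSemigroup = record
                { isMagma = record { isEquivalence = isEquivalence ; ∙-cong = +-cong }
                ; assoc = +-assoc
                }
              ; identity = +-identityˡ , +-identityʳ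
              }
            ; inverse = (λ p → trans (+-comm (- p) p) (+-inverseʳ p)) , +-inverseʳ
            ; ⁻¹-cong = neg-cong
            }
          ; comm = +-comm
          }
        ; *-cong = *-cong
        ; *-assoc = *-assoc
        ; *-identity = *-identityˡ , λ p → trans (*-comm p (const R.1#)) (*-identityˡ p)
        ; distrib = (λ p q r → trans (*-comm p (q + r)) (trans (*-distribʳ p q r)
                                 (+-cong (*-comm q p) (*-comm r p))))
                  , *-distribʳ
        }
      ; *-comm = *-comm
      }

    ∷-≈[] : ∀ {a p} → a R.≈ R.0# → p ≈ [] → a ∷ p ≈ []
    ∷-≈[] e ([ f ]) = [ (λ { zero → e ; (suc n) → f n }) ]

    cons-cong : ∀ {a b p} → a R.≈ b → a ∷ p ≈ b ∷ p
    cons-cong e = [ (λ { zero → e ; (suc n) → R.refl }) ]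

    unshift : ∀ {p} → R.0# ∷ p ≈ [] → p ≈ []
    unshift ([ e ]) = [ (λ n → e (suc n)) ]

    ∷-*-∷-≉[] : ∀ a p b q → ¬ a ∷ p ≈ [] → ¬ b ∷ q ≈ [] →
                (¬ p ≈ [] → ¬ p * (b ∷ q) ≈ []) → (¬ q ≈ [] → ¬ (a ∷ p) * q ≈ []) →
                ¬ (a ∷ p) * (b ∷ q) ≈ []
    ∷-*-∷-≉[] a p b q p≉0 q≉0 rec-p rec-q pq≈0 =
      R.*-≉0 a≉0 b≉0 (R.trans (R.sym (coeff-*-zero a p (b ∷ q))) (at pq≈0 0))
      where
      open SetoidReasoning setoid
      a≉0 : ¬ a R.≈ R.0#
      a≉0 a≈0 = rec-p (λ p≈0 → p≉0 (∷-≈[] a≈0 p≈0)) (unshift (begin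
        R.0# ∷ p * (b ∷ q)    ≈⟨ sym (shift-* p (b ∷ q)) ⟩
        (R.0# ∷ p) * (b ∷ q)  ≈⟨ *-congʳ (R.0# ∷ p) (a ∷ p) (b ∷ q) (cons-cong (R.sym a≈0)) ⟩
        (a ∷ p) * (b ∷ q)     ≈⟨ pq≈0 ⟩
        []                    ∎))
      b≉0 : ¬ b R.≈ R.0#
      b≉0 b≈0 = rec-q (λ q≈0 → q≉0 (∷-≈[] b≈0 q≈0)) (unshift (begin
        R.0# ∷ (a ∷ p) * q                      ≈⟨ +-cong (sym (0-· (a ∷ p))) refl ⟩
        R.0# · (a ∷ p) + (R.0# ∷ (a ∷ p) * q)   ≈⟨ +-cong (·-cong {p = a ∷ p} (R.sym b≈0) refl) (refl {R.0# ∷ (a ∷ p) * q}) ⟩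
        b · (a ∷ p) + (R.0# ∷ (a ∷ p) * q)      ≈⟨ sym (*-∷ (a ∷ p) b q) ⟩
        (a ∷ p) * (b ∷ q)                       ≈⟨ pq≈0 ⟩
        []                                      ∎))

    *-≉[] : ∀ p q → ¬ p ≈ [] → ¬ q ≈ [] → ¬ p * q ≈ []
    *-≉[] []      q       p≉0 q≉0 _ = p≉0 refl
    *-≉[] (a ∷ p) []      p≉0 q≉0 _ = q≉0 refl
    *-≉[] (a ∷ p) (b ∷ q) p≉0 q≉0   = ∷-*-∷-≉[] a p b q p≉0 q≉0
      (λ p≉0 → *-≉[] p (b ∷ q) p≉0 q≉0) (λ q≉0 → *-≉[] (a ∷ p) q p≉0 q≉0)

  poly-domain : IntegralDomain
  poly-domain = noZeroDivisors⇒domain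
    (record { isCommutativeRing = isCommutativeRing })
    (λ ([ e ]) → R.1≉0 (e 0))
    (λ p q ¬¬p≈q → [ (λ n → R.≈-stable _ _ λ ¬e → ¬¬p≈q λ ([ e ]) → ¬e (e n)) ])
    (λ {p} {q} → *-≉[] p q)

-- R[x₁,…,xₘ] = R[x₂,…,xₘ][x₁]; variables are numbered by Fin m.

MvPoly : IntegralDomain → ℕ → IntegralDomain
MvPoly R zero    = R
MvPoly R (suc m) = Polynomial.poly-domain (MvPoly R m)

module _ {R : IntegralDomain} where

  var : ∀ {m} → Fin m → IntegralDomain.Carrier (MvPoly R m)
  var {suc m} zero    = Polynomial.X (MvPoly R m)
  var {suc m} (suc k) = Polynomial.const (MvPoly R m) (var k)

  ∂ : ∀ {m} → Fin m → IntegralDomain.Carrier (MvPoly R m) → IntegralDomain.Carrier (MvPoly R m)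
  ∂ {suc m} zero    = Polynomial.derivative (MvPoly R m)
  ∂ {suc m} (suc k) = List.map (∂ k)

module FractionField (R : IntegralDomain) where
  private
    module R = IntegralDomain R
    open RingProperties R.ring using (-‿distribˡ-*)

  record Fraction : Set where
    constructor _/_[_]
    field
      num den : R.Carrier
      den≉0   : ¬ den R.≈ R.0#
  open Fraction public

  infix  4 _≈_
  infixl 6 _+_
  infixl 7 _*_
  infix  8 -_

  record _≈_ (x y : Fraction) : Set where
    constructor [_]
    field cross : num x R.* den y R.≈ num y R.* den x
  open _≈_ public

  fromDomain : R.Carrier → Fraction
  fromDomain a = a / R.1# [ R.1≉0 ]

  _+_ : Fraction → Fraction → Fraction
  (a / b [ b≉0 ]) + (c / d [ d≉0 ]) = (a R.* d R.+ c R.* b) / b R.* d [ R.*-≉0 b≉0 d≉0 ]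

  _*_ : Fraction → Fraction → Fraction
  (a / b [ b≉0 ]) * (c / d [ d≉0 ]) = (a R.* c) / b R.* d [ R.*-≉0 b≉0 d≉0 ]

  -_ : Fraction → Fraction
  - (a / b [ b≉0 ]) = (R.- a) / b [ b≉0 ]

  recip : (x : Fraction) → ¬ x ≈ fromDomain R.0# → Fraction
  recip x x≉0 = den x / num x [ (λ num≈0 → x≉0
    [ R.trans (R.*-congʳ num≈0) (R.trans (R.zeroˡ _) (R.sym (R.zeroˡ _))) ]) ]

  private
    open SemiringSolver R.commutativeSemiring using (solve; _:+_; _:*_; _:=_; con)

    isEquivalence : IsEquivalence _≈_
    isEquivalence = record
      { refl  = [ R.refl ]
      ; sym   = λ ([ e ]) → [ R.sym e ]
      ; trans = λ {x} {y} {z} ([ e ]) ([ f ]) → [ R.*-cancel (den y) _ _ (den≉0 y) (begin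
          den y R.* (num x R.* den z)  ≈⟨ rot (den y) (num x) (den z) ⟩
          (num x R.* den y) R.* den z  ≈⟨ R.*-congʳ e ⟩
          (num y R.* den x) R.* den z  ≈⟨ swap (num y) (den x) (den z) ⟩
          (num y R.* den z) R.* den x  ≈⟨ R.*-congʳ f ⟩
          (num z R.* den y) R.* den x  ≈⟨ R.sym (rot (den y) (num z) (den x)) ⟩
          den y R.* (num z R.* den x)  ∎) ]
      }
      where
      open SetoidReasoning R.setoid
      rot : ∀ a b c → a R.* (b R.* c) R.≈ (b R.* a) R.* c
      rot = solve 3 (λ a b c → a :* (b :* c) := (b :* a) :* c) R.refl
      swap : ∀ a b c → (a R.* b) R.* c R.≈ (a R.* c) R.* b
      swap = solve 3 (λ a b c → (a :* b) :* c := (a :* c) :* b) R.refl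

    +-cong : ∀ {x x′ y y′} → x ≈ x′ → y ≈ y′ → x + y ≈ x′ + y′
    +-cong {a / b [ _ ]} {a′ / b′ [ _ ]} {c / d [ _ ]} {c′ / d′ [ _ ]} ([ e ]) ([ f ]) = [ (begin
      (a R.* d R.+ c R.* b) R.* (b′ R.* d′)
        ≈⟨ expand a b c d b′ d′ ⟩
      (a R.* b′) R.* (d R.* d′) R.+ (c R.* d′) R.* (b R.* b′)
        ≈⟨ R.+-cong (R.*-congʳ e) (R.*-congʳ f) ⟩
      (a′ R.* b) R.* (d R.* d′) R.+ (c′ R.* d) R.* (b R.* b′)
        ≈⟨ collect a′ b c′ d b′ d′ ⟩
      (a′ R.* d′ R.+ c′ R.* b′) R.* (b R.* d) ∎) ]
      where
      open SetoidReasoning R.setoid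
      expand : ∀ a b c d b′ d′ → (a R.* d R.+ c R.* b) R.* (b′ R.* d′) R.≈
               (a R.* b′) R.* (d R.* d′) R.+ (c R.* d′) R.* (b R.* b′)
      expand = solve 6 (λ a b c d b′ d′ → (a :* d :+ c :* b) :* (b′ :* d′) :=
                 (a :* b′) :* (d :* d′) :+ (c :* d′) :* (b :* b′)) R.refl
      collect : ∀ a b c d b′ d′ → (a R.* b) R.* (d R.* d′) R.+ (c R.* d) R.* (b R.* b′) R.≈
                (a R.* d′ R.+ c R.* b′) R.* (b R.* d)
      collect = solve 6 (λ a b c d b′ d′ → (a :* b) :* (d :* d′) :+ (c :* d) :* (b :* b′) :=
                  (a :* d′ :+ c :* b′) :* (b :* d)) R.refl

    *-cong : ∀ {x x′ y y′} → x ≈ x′ → y ≈ y′ → x * y ≈ x′ * y′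
    *-cong {a / b [ _ ]} {a′ / b′ [ _ ]} {c / d [ _ ]} {c′ / d′ [ _ ]} ([ e ]) ([ f ]) = [ (begin
      (a R.* c) R.* (b′ R.* d′)  ≈⟨ exchange a c b′ d′ ⟩
      (a R.* b′) R.* (c R.* d′)  ≈⟨ R.*-cong e f ⟩
      (a′ R.* b) R.* (c′ R.* d)  ≈⟨ exchange a′ b c′ d ⟩
      (a′ R.* c′) R.* (b R.* d)  ∎) ]
      where
      open SetoidReasoning R.setoid
      exchange : ∀ a b c d → (a R.* b) R.* (c R.* d) R.≈ (a R.* c) R.* (b R.* d)
      exchange = solve 4 (λ a b c d → (a :* b) :* (c :* d) := (a :* c) :* (b :* d)) R.refl

    neg-cong : ∀ {x y} → x ≈ y → - x ≈ - y
    neg-cong {a / b [ _ ]} {c / d [ _ ]} ([ e ]) =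
      [ R.trans (R.sym (-‿distribˡ-* a d)) (R.trans (R.-‿cong e) (-‿distribˡ-* c b)) ]

    +-assoc : ∀ x y z → (x + y) + z ≈ x + (y + z)
    +-assoc (a / b [ _ ]) (c / d [ _ ]) (e / f [ _ ]) = [ solve 6 (λ a b c d e f →
      ((a :* d :+ c :* b) :* f :+ e :* (b :* d)) :* (b :* (d :* f)) :=
      (a :* (d :* f) :+ (c :* f :+ e :* d) :* b) :* ((b :* d) :* f)) R.refl a b c d e f ]

    +-comm : ∀ x y → x + y ≈ y + x
    +-comm (a / b [ _ ]) (c / d [ _ ]) = [ solve 4 (λ a b c d →
      (a :* d :+ c :* b) :* (d :* b) := (c :* b :+ a :* d) :* (b :* d)) R.refl a b c d ]

    +-identityˡ : ∀ x → fromDomain R.0# + x ≈ x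
    +-identityˡ (a / b [ _ ]) = [ solve 2 (λ a b →
      (con 0 :* b :+ a :* con 1) :* b := a :* (con 1 :* b)) R.refl a b ]

    +-inverseˡ : ∀ x → - x + x ≈ fromDomain R.0#
    +-inverseˡ (a / b [ _ ]) = [ (begin
      (R.- a R.* b R.+ a R.* b) R.* R.1#  ≈⟨ R.*-congʳ (R.sym (R.distribʳ b (R.- a) a)) ⟩
      ((R.- a R.+ a) R.* b) R.* R.1#      ≈⟨ R.*-congʳ (R.*-congʳ (R.-‿inverseˡ a)) ⟩
      (R.0# R.* b) R.* R.1#               ≈⟨ R.*-congʳ (R.zeroˡ b) ⟩
      R.0# R.* R.1#                       ≈⟨ R.zeroˡ R.1# ⟩
      R.0#                                ≈⟨ R.sym (R.zeroˡ (b R.* b)) ⟩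
      R.0# R.* (b R.* b)                  ∎) ]
      where open SetoidReasoning R.setoid

    *-assoc : ∀ x y z → (x * y) * z ≈ x * (y * z)
    *-assoc (a / b [ _ ]) (c / d [ _ ]) (e / f [ _ ]) = [ solve 6 (λ a b c d e f →
      ((a :* c) :* e) :* (b :* (d :* f)) := (a :* (c :* e)) :* ((b :* d) :* f)) R.refl a b c d e f ]

    *-comm : ∀ x y → x * y ≈ y * x
    *-comm (a / b [ _ ]) (c / d [ _ ]) = [ solve 4 (λ a b c d →
      (a :* c) :* (d :* b) := (c :* a) :* (b :* d)) R.refl a b c d ]

    *-identityˡ : ∀ x → fromDomain R.1# * x ≈ x
    *-identityˡ (a / b [ _ ]) = [ solve 2 (λ a b →
      (con 1 :* a) :* b := a :* (con 1 :* b)) R.refl a b ]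

    *-distribʳ : ∀ x y z → (y + z) * x ≈ y * x + z * x
    *-distribʳ (a / b [ _ ]) (c / d [ _ ]) (e / f [ _ ]) = [ solve 6 (λ a b c d e f →
      ((c :* f :+ e :* d) :* a) :* ((d :* b) :* (f :* b)) :=
      ((c :* a) :* (f :* b) :+ (e :* a) :* (d :* b)) :* ((d :* f) :* b)) R.refl a b c d e f ]

    open IsEquivalence isEquivalence using (trans)

    isCommutativeRing : IsCommutativeRing _≈_ _+_ _*_ -_ (fromDomain R.0#) (fromDomain R.1#)
    isCommutativeRing = record
      { isRing = record
        { +-isAbelianGroup = record
          { isGroup = record
            { isMonoid = record
              { isSemigroup = record
                { isMagma = record { isEquivalence = isEquivalence ; ∙-cong = +-cong }
                ; assoc = +-assoc
                }
              ; identity = +-identityˡ , λ x → trans (+-comm x (fromDomain R.0#)) (+-identityˡ x)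
              }
            ; inverse = +-inverseˡ , λ x → trans (+-comm x (- x)) (+-inverseˡ x)
            ; ⁻¹-cong = neg-cong
            }
          ; comm = +-comm
          }
        ; *-cong = *-cong
        ; *-assoc = *-assoc
        ; *-identity = *-identityˡ , λ x → trans (*-comm x (fromDomain R.1#)) (*-identityˡ x)
        ; distrib = (λ x y z → trans (*-comm x (y + z)) (trans (*-distribʳ x y z)
                                 (+-cong (*-comm y x) (*-comm z x))))
                  , *-distribʳ
        }
      ; *-comm = *-comm
      }

  commutativeRing : CommutativeRing 0ℓ 0ℓ
  commutativeRing = record { isCommutativeRing = isCommutativeRing }

  *-recip : ∀ x x≉0 → x * recip x x≉0 ≈ fromDomain R.1#
  *-recip (a / b [ _ ]) _ = [ solve 2 (λ a b →
    (a :* b) :* con 1 := con 1 :* (b :* a)) R.refl a b ]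

module LinearAlgebra (R : CommutativeRing 0ℓ 0ℓ) where
  open CommutativeRing R
  open Summation +-commutativeMonoid using (sum)

  Matrix : ℕ → ℕ → Set
  Matrix m n = Fin m → Fin n → Carrier

  I : ∀ {n} → Matrix n n
  I i j with i Fin.≟ j
  ... | yes _ = 1#
  ... | no  _ = 0#

  infixl 6 _⊖_
  infixl 7 _⊗_ _⊙_

  _⊖_ : ∀ {m n} → Matrix m n → Matrix m n → Matrix m n
  (A ⊖ B) i j = A i j - B i j

  _⊗_ : ∀ {l m n} → Matrix l m → Matrix m n → Matrix l n
  (A ⊗ B) i k = sum λ j → A i j * B j k

  _⊙_ : ∀ {m n} → Carrier → Matrix m n → Matrix m n
  (a ⊙ A) i j = a * A i j

  _ᵀ : ∀ {m n} → Matrix m n → Matrix n m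
  (A ᵀ) i j = A j i

  -- Columns are taken with their positions: equal columns at two different
  -- positions in S are dependent.
  IndependentColumns : ∀ {m n} → Matrix m n → Subset n → Set
  IndependentColumns {m} {n} A S =
    (c : Fin n → Carrier) →
    (∀ e → e ∉ S → c e ≈ 0#) →
    (∀ θ → sum (λ e → c e * A θ e) ≈ 0#) →
    ∀ e → c e ≈ 0#

record Digraph (n : ℕ) : Set where
  field
    D      : Fin n → Fin n → Bool
    noLoop : ∀ i → D i i ≡ false

  infix 4 _⟶_
  _⟶_ : Fin n → Fin n → Set
  i ⟶ j = T (D i j)

  Adjacent : Fin n → Fin n → Set
  Adjacent i j = i ⟶ j ⊎ j ⟶ i

  Simple : Set
  Simple = ∀ i j → ¬ (i ⟶ j × j ⟶ i)

  Complete : Set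
  Complete = ∀ i j → i ≢ j → Adjacent i j

  TransitiveTriangle : Fin n → Fin n → Fin n → Set
  TransitiveTriangle i j k = i ⟶ k × j ⟶ k × Adjacent i j

  TransitiveTriangleFree : Set
  TransitiveTriangleFree = ∀ i j k → ¬ TransitiveTriangle i j k

  edges : List (Fin n × Fin n)
  edges = filter (λ (i , j) → T? (D i j)) (cartesianProduct (allFin n) (allFin n))

  edgeIndex : ∀ {i j} → i ⟶ j → Fin (List.length edges)
  edgeIndex {i} {j} i⟶j = index (∈-edges i⟶j)
    where
    ∈-edges : i ⟶ j → (i , j) ∈ₗ edges
    ∈-edges = ∈-filter⁺ (λ (i , j) → T? (D i j)) (∈-cartesianProduct⁺ (∈-allFin i) (∈-allFin j))

infix 4 _≐_
_≐_ : ∀ {n} → Digraph n → Digraph n → Set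
G ≐ H = ∀ i j → Digraph.D G i j ≡ Digraph.D H i j

-- The ground set: the positions (i , j), i ≤ j, of the symmetric matrix K.
positions : ∀ n → List (Fin n × Fin n)
positions n = filter (λ (i , j) → i Fin.≤? j) (cartesianProduct (allFin n) (allFin n))

#positions : ℕ → ℕ
#positions n = List.length (positions n)

module Parametrization {n : ℕ} (G : Digraph n) where
  open Digraph G

  -- Indeterminate zero is s; indeterminate suc e is λ at the e-th edge.
  #indeterminates : ℕ
  #indeterminates = suc (List.length edges)

  ℝ[λ,s] : IntegralDomain
  ℝ[λ,s] = MvPoly Real.ℝ-domain #indeterminates

  open IntegralDomain ℝ[λ,s] using (Carrier; 0#; commutativeRing)
  open LinearAlgebra commutativeRing
  module ℝ⟨λ,s⟩ = FractionField ℝ[λ,s]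

  s : Carrier
  s = var {Real.ℝ-domain} {#indeterminates} zero

  Λ : Matrix n n
  Λ i j with T? (D i j)
  ... | yes i⟶j = var {Real.ℝ-domain} {#indeterminates} (suc (edgeIndex i⟶j))
  ... | no  _   = 0#

  ψ : Matrix n n
  ψ = s ⊙ ((I ⊖ Λ) ⊗ (I ⊖ Λ) ᵀ)

  J : Fin #indeterminates → Fin (#positions n) → Carrier
  J θ e = ∂ {Real.ℝ-domain} θ (uncurry ψ (List.lookup (positions n) e))

-- A matroid on #positions n elements, given by its independent sets.
JacobianMatroid : ∀ {n} → Digraph n → Subset (#positions n) → Set
JacobianMatroid G = IndependentColumns λ θ e → ℝ⟨λ,s⟩.fromDomain (J θ e)
  where
  open Parametrization G
  open LinearAlgebra ℝ⟨λ,s⟩.commutativeRing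

SameMatroid : ∀ {m} → (Subset m → Set) → (Subset m → Set) → Set
SameMatroid M N = ∀ S → M S ⇔ N S

{-# OPTIONS --safe #-}

-- Since G has no transitive triangles, K_ij = - s λ_ij on an edge i → j, and
--   dK_ll + 2 Σ_k λ_lk dK_lk = (1 - Σ_k λ_lk²) ds,
-- so for l ≠ l′ the diagonal positions ll, l′l′ and the edges leaving l or l′ form a circuit.
-- Suppose G and H have the same matroid and l → m is in G but not in H. If some other l′ had no
-- edge l′ → m in G, then lm would be the only element of the circuit of l and l′ touching m.
-- If lm is not a loop for H, the columns of K in H involve a variable λ_mk that occurs in
-- K_lm and otherwise only in columns touching m, so lm is a coloop of the circuit: impossible.
-- Hence G consists of all edges into m. By symmetry H lies in G, making lm a loop of H, or
-- H consists of all edges into some q ≠ m; then a third node r exists by incompleteness, and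
-- mm, rr, rm is a circuit for G but independent for H, with determinant - 2 s² (λ_mq² + λ_rq²).

module Submission where

open import Algebra.Bundles using (CommutativeMonoid; CommutativeRing)
import Algebra.Properties.CommutativeSemigroup as CommutativeSemigroupProperties
import Algebra.Properties.Group as GroupProperties
import Algebra.Properties.Ring as RingProperties
import Algebra.Properties.Semiring.Sum as SemiringSum
import Algebra.Solver.Ring.NaturalCoefficients.Default as SemiringSolver
open import Data.Bool.Base using (true; false; T)
open import Data.Bool.Properties using (T?; T-irrelevant)
open import Data.Fin.Base as Fin using (Fin; zero; suc)
import Data.Fin.Properties as Fin
open import Data.Fin.Subset using (Subset; _∈_; _∉_)
open import Data.List.Base as List using (List; []; _∷_; lookup; allFin; cartesianProduct)
open import Data.List.Membership.Propositional using () renaming (_∈_ to _∈ₗ_)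
open import Data.List.Membership.Propositional.Properties
  using (∈-filter⁺; ∈-filter⁻; ∈-cartesianProduct⁺; ∈-allFin; ∈-lookup)
import Data.List.Relation.Unary.All as All
open import Data.List.Relation.Unary.AllPairs using ([]; _∷_)
open import Data.List.Relation.Unary.Any using (index)
open import Data.List.Relation.Unary.Any.Properties using (lookup-index)
open import Data.List.Relation.Unary.Unique.Propositional using (Unique)
import Data.List.Relation.Unary.Unique.Propositional.Properties as Unique
open import Data.Nat.Base using (ℕ; zero; suc)
import Data.Nat.Properties as ℕ
open import Data.Product.Base using (_×_; _,_; ∃-syntax; Σ-syntax; proj₁; proj₂; uncurry; map₂)
open import Data.Rational.Base as ℚ using (0ℚ; 1ℚ)
import Data.Rational.Properties as ℚ
open import Data.Sum.Base using (_⊎_; inj₁; inj₂)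
import Data.Vec.Base as Vec
open import Data.Vec.Properties using (lookup∘tabulate; []=⇒lookup; lookup⇒[]=)
open import Function.Base using (_∘_)
open import Function.Bundles using (_⇔_; mk⇔; Equivalence)
open import Function.Construct.Symmetry using (⇔-sym)
open import Relation.Binary.PropositionalEquality.Core as ≡ using (_≡_; _≢_)
import Relation.Binary.Reasoning.Setoid as SetoidReasoning
open import Relation.Nullary using (¬_; Dec; yes; no; does)
open import Relation.Nullary.Decidable
  using (_×-dec_; _⊎-dec_; ¬?; map′; decidable-stable; dec-true; from-yes)
open import Relation.Nullary.Negation using (contradiction)
open import Relation.Unary using (Decidable)
open import Defs

-- Derivations

-- Triangle-freeness is what makes `K` tractable: a common child of two adjacent nodes would
-- complete a transitive triangle, so on an edge the quadratic part of `K` is absent. The edge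
-- positions therefore meet the edge rows of the Jacobian in `- s` times an identity matrix, and the
-- combinations `f l` extend this control to the diagonal: subtracting multiples of `f l` and `f l′`
-- turns any relation on the edges and two diagonal positions into a relation on edges alone. What
-- remains of `f l` is `w l` times `ds` with `w l` a nonzero polynomial, so it takes the stars of
-- two nodes to cancel it. Independence is moved from fractions to polynomials by clearing
-- denominators. The graph argument then knows the polynomials only through their partial
-- derivatives: an element is nonzero because some derivative of it is. Derivatives of squares are
-- doubles, which is why the characteristic must not be 2.

record Char≢2 (R : IntegralDomain) : Set where
  open IntegralDomain R
  field 2≉0 : ¬ 1# + 1# ≈ 0#
open Char≢2

record IsDerivation (R : IntegralDomain) (d : IntegralDomain.Carrier R → IntegralDomain.Carrier R) : Set where
  open IntegralDomain R
  open RingProperties ring using (x+x≈x⇒x≈0)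
  open SemiringSum semiring using (sum)
  field
    cong    : ∀ {x y} → x ≈ y → d x ≈ d y
    +-homo  : ∀ x y → d (x + y) ≈ d x + d y
    leibniz : ∀ x y → d (x * y) ≈ d x * y + x * d y

  0-homo : d 0# ≈ 0#
  0-homo = x+x≈x⇒x≈0 (d 0#) (trans (sym (+-homo 0# 0#)) (cong (+-identityˡ 0#)))

  1-vanishes : d 1# ≈ 0#
  1-vanishes = x+x≈x⇒x≈0 (d 1#) (sym (trans (cong (sym (*-identityˡ 1#)))
    (trans (leibniz 1# 1#) (+-cong (*-identityʳ _) (*-identityˡ _)))))

  -‿homo : ∀ x → d (- x) ≈ - d x
  -‿homo x = GroupProperties.inverseˡ-unique +-group (d (- x)) (d x)
    (trans (sym (+-homo (- x) x)) (trans (cong (-‿inverseˡ x)) 0-homo))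

  sum-homo : ∀ {m} (f : Fin m → Carrier) → d (sum f) ≈ sum (d ∘ f)
  sum-homo {zero}  f = 0-homo
  sum-homo {suc m} f = trans (+-homo _ _) (+-congˡ (sum-homo (f ∘ suc)))

  *-vanishes : ∀ {x y} → d x ≈ 0# → d y ≈ 0# → d (x * y) ≈ 0#
  *-vanishes {x} {y} dx≈0 dy≈0 = trans (leibniz x y) (trans
    (+-cong (trans (*-congʳ dx≈0) (zeroˡ y)) (trans (*-congˡ dy≈0) (zeroʳ x))) (+-identityˡ 0#))

module _ (R : IntegralDomain) where
  private
    module R = IntegralDomain R
  open IntegralDomain (Polynomial.poly-domain R)
  open Polynomial R using (coeff; [_]; _·_; derivative; coeff-+; coeff-·)
  open CommutativeSemigroupProperties (CommutativeMonoid.commutativeSemigroup +-commutativeMonoid)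
    using (interchange)
  open SetoidReasoning setoid

  private
    shift-cong : ∀ {p q} → p ≈ q → R.0# ∷ p ≈ R.0# ∷ q
    shift-cong ([ e ]) = [ (λ { zero → R.refl ; (suc n) → e n }) ]

    shift-[] : R.0# ∷ [] ≈ []
    shift-[] = [ (λ { zero → R.refl ; (suc n) → R.refl }) ]

    shift-+ : ∀ p q → R.0# ∷ (p + q) ≈ (R.0# ∷ p) + (R.0# ∷ q)
    shift-+ p q = [ (λ { zero → R.sym (R.+-identityʳ _) ; (suc n) → R.refl }) ]

    tail≈ : ∀ {a b p q} → a ∷ p ≈ b ∷ q → p ≈ q
    tail≈ ([ e ]) = [ (λ n → e (suc n)) ]

    tail≈[] : ∀ {a p} → a ∷ p ≈ [] → p ≈ []
    tail≈[] ([ e ]) = [ (λ n → e (suc n)) ]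

    derivative-[] : ∀ p → p ≈ [] → derivative p ≈ []
    derivative-[] []      e = refl
    derivative-[] (a ∷ p) e = begin
      p + (R.0# ∷ derivative p)  ≈⟨ +-cong (tail≈[] e) (shift-cong (derivative-[] p (tail≈[] e))) ⟩
      [] + (R.0# ∷ [])           ≈⟨ shift-[] ⟩
      []                         ∎

    derivative-cong : ∀ p q → p ≈ q → derivative p ≈ derivative q
    derivative-cong []      q       e = sym (derivative-[] q (sym e))
    derivative-cong (a ∷ p) []      e = derivative-[] (a ∷ p) e
    derivative-cong (a ∷ p) (b ∷ q) e =
      +-cong (tail≈ e) (shift-cong (derivative-cong p q (tail≈ e)))

    derivative-+ : ∀ p q → derivative (p + q) ≈ derivative p + derivative q
    derivative-+ []      q       = refl
    derivative-+ (a ∷ p) []      = sym (+-identityʳ _)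
    derivative-+ (a ∷ p) (b ∷ q) = begin
      (p + q) + (R.0# ∷ derivative (p + q))
        ≈⟨ +-congˡ (trans (shift-cong (derivative-+ p q)) (shift-+ (derivative p) (derivative q))) ⟩
      (p + q) + ((R.0# ∷ derivative p) + (R.0# ∷ derivative q))
        ≈⟨ interchange p q _ _ ⟩
      derivative (a ∷ p) + derivative (b ∷ q) ∎

    ·-shift : ∀ a p → a · (R.0# ∷ p) ≈ R.0# ∷ a · p
    ·-shift a p = [ (λ { zero → R.zeroʳ a ; (suc n) → R.refl }) ]

    ·-+ : ∀ a p q → a · (p + q) ≈ a · p + a · q
    ·-+ a p q = [ (λ n → R.trans (coeff-· a (p + q) n) (R.trans (R.*-congˡ (coeff-+ p q n))
      (R.trans (R.distribˡ a _ _) (R.sym (R.trans (coeff-+ (a · p) (a · q) n)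
        (R.+-cong (coeff-· a p n) (coeff-· a q n))))))) ]

    derivative-· : ∀ a p → derivative (a · p) ≈ a · derivative p
    derivative-· a []      = refl
    derivative-· a (b ∷ p) = begin
      a · p + (R.0# ∷ derivative (a · p))  ≈⟨ +-congˡ (shift-cong (derivative-· a p)) ⟩
      a · p + (R.0# ∷ a · derivative p)    ≈⟨ +-congˡ (·-shift a (derivative p)) ⟨
      a · p + a · (R.0# ∷ derivative p)    ≈⟨ ·-+ a p _ ⟨
      a · (p + (R.0# ∷ derivative p))      ∎

    shift-* : ∀ p q → (R.0# ∷ p) * q ≈ R.0# ∷ p * q
    shift-* p q = +-congʳ {R.0# ∷ p * q} {R.0# · q} {[]}
      [ (λ n → R.trans (coeff-· R.0# q n) (R.zeroˡ _)) ]

    derivative-* : ∀ p q → derivative (p * q) ≈ derivative p * q + p * derivative q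
    derivative-* []      q = refl
    derivative-* (a ∷ p) q = begin
      derivative (a · q + (R.0# ∷ p * q))
        ≈⟨ derivative-+ (a · q) _ ⟩
      derivative (a · q) + (p * q + (R.0# ∷ derivative (p * q)))
        ≈⟨ +-cong (derivative-· a q) (+-congˡ {p * q}
             (trans (shift-cong (derivative-* p q)) (shift-+ (derivative p * q) (p * derivative q)))) ⟩
      a · derivative q + (p * q + ((R.0# ∷ derivative p * q) + (R.0# ∷ p * derivative q)))
        ≈⟨ +-congˡ {a · derivative q} (+-assoc (p * q) _ _) ⟨
      a · derivative q + ((p * q + (R.0# ∷ derivative p * q)) + (R.0# ∷ p * derivative q))
        ≈⟨ +-assoc (a · derivative q) _ _ ⟨
      (a · derivative q + (p * q + (R.0# ∷ derivative p * q))) + (R.0# ∷ p * derivative q)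
        ≈⟨ +-congʳ (+-comm (a · derivative q) _) ⟩
      ((p * q + (R.0# ∷ derivative p * q)) + a · derivative q) + (R.0# ∷ p * derivative q)
        ≈⟨ +-assoc (p * q + (R.0# ∷ derivative p * q)) (a · derivative q) _ ⟩
      (p * q + (R.0# ∷ derivative p * q)) + (a ∷ p) * derivative q
        ≈⟨ +-congʳ (trans (distribʳ q p _) (+-congˡ {p * q} (shift-* (derivative p) q))) ⟨
      derivative (a ∷ p) * q + (a ∷ p) * derivative q ∎

  derivative-isDerivation : IsDerivation (Polynomial.poly-domain R) derivative
  derivative-isDerivation = record
    { cong    = λ {p} {q} → derivative-cong p q
    ; +-homo  = derivative-+
    ; leibniz = derivative-*
    }

  module _ (d : R.Carrier → R.Carrier) (isDerivation : IsDerivation R d) where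
    private
      module d = IsDerivation isDerivation

      coeff-map : ∀ p n → coeff (List.map d p) n R.≈ d (coeff p n)
      coeff-map []      n       = R.sym d.0-homo
      coeff-map (a ∷ p) zero    = R.refl
      coeff-map (a ∷ p) (suc n) = coeff-map p n

      map-cong : ∀ {p q} → p ≈ q → List.map d p ≈ List.map d q
      map-cong {p} {q} ([ e ]) = [ (λ n →
        R.trans (coeff-map p n) (R.trans (d.cong (e n)) (R.sym (coeff-map q n)))) ]

      map-+ : ∀ p q → List.map d (p + q) ≈ List.map d p + List.map d q
      map-+ p q = [ (λ n → R.trans (coeff-map (p + q) n) (R.trans (d.cong (coeff-+ p q n))
        (R.trans (d.+-homo _ _) (R.sym (R.trans (coeff-+ (List.map d p) (List.map d q) n)
          (R.+-cong (coeff-map p n) (coeff-map q n))))))) ]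

      map-· : ∀ a p → List.map d (a · p) ≈ d a · p + a · List.map d p
      map-· a p = [ (λ n → R.trans (coeff-map (a · p) n) (R.trans (d.cong (coeff-· a p n))
        (R.trans (d.leibniz _ _) (R.sym (R.trans (coeff-+ (d a · p) (a · List.map d p) n)
          (R.+-cong (coeff-· (d a) p n)
            (R.trans (coeff-· a (List.map d p) n) (R.*-congˡ (coeff-map p n))))))))) ]

      map-shift : ∀ p → List.map d (R.0# ∷ p) ≈ R.0# ∷ List.map d p
      map-shift p = [ (λ { zero → d.0-homo ; (suc n) → R.refl }) ]

      map-* : ∀ p q → List.map d (p * q) ≈ List.map d p * q + p * List.map d q
      map-* []      q = refl
      map-* (a ∷ p) q = begin
        List.map d (a · q + (R.0# ∷ p * q))
          ≈⟨ map-+ (a · q) _ ⟩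
        List.map d (a · q) + List.map d (R.0# ∷ p * q)
          ≈⟨ +-cong (map-· a q) (trans (map-shift (p * q)) (trans (shift-cong (map-* p q))
               (shift-+ (List.map d p * q) (p * List.map d q)))) ⟩
        (d a · q + a · List.map d q) + ((R.0# ∷ List.map d p * q) + (R.0# ∷ p * List.map d q))
          ≈⟨ interchange (d a · q) _ _ _ ⟩
        List.map d (a ∷ p) * q + (a ∷ p) * List.map d q ∎

    -- Acting on coefficients treats the polynomial's own variable as a constant. This is the
    -- induction step for `∂` at every variable but the first.
    map-isDerivation : IsDerivation (Polynomial.poly-domain R) (List.map d)
    map-isDerivation = record { cong = map-cong ; +-homo = map-+ ; leibniz = map-* }

-- Partial derivatives of polynomials in several variables

module _ {R : IntegralDomain} where
  private
    module P m = IntegralDomain (MvPoly R m)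

  ∂-isDerivation : ∀ {m} (i : Fin m) → IsDerivation (MvPoly R m) (∂ {R} i)
  ∂-isDerivation {suc m} zero    = derivative-isDerivation (MvPoly R m)
  ∂-isDerivation {suc m} (suc i) = map-isDerivation (MvPoly R m) (∂ {R} i) (∂-isDerivation i)

  ∂-var-self : ∀ {m} (i : Fin m) → P._≈_ m (∂ {R} i (var {R} i)) (P.1# m)
  ∂-var-self {suc m} zero    = Polynomial.[ (λ
    { zero → P.+-identityʳ m _ ; (suc zero) → P.refl m ; (suc (suc n)) → P.refl m }) ]
  ∂-var-self {suc m} (suc i) = Polynomial.[ (λ
    { zero → ∂-var-self i ; (suc n) → P.refl m }) ]

  ∂-var-other : ∀ {m} {i j : Fin m} → i ≢ j → P._≈_ m (∂ {R} i (var {R} j)) (P.0# m)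
  ∂-var-other {suc m} {zero}  {zero}  i≢j = contradiction ≡.refl i≢j
  ∂-var-other {suc m} {zero}  {suc j} i≢j = Polynomial.[ (λ { zero → P.refl m ; (suc n) → P.refl m }) ]
  ∂-var-other {suc m} {suc i} {zero}  i≢j = Polynomial.[ (λ
    { zero → d.0-homo ; (suc zero) → d.1-vanishes ; (suc (suc n)) → P.refl m }) ]
    where module d = IsDerivation (∂-isDerivation i)
  ∂-var-other {suc m} {suc i} {suc j} i≢j = Polynomial.[ (λ
    { zero → ∂-var-other (i≢j ∘ ≡.cong suc) ; (suc n) → P.refl m }) ]

  MvPoly-Char≢2 : Char≢2 R → ∀ m → Char≢2 (MvPoly R m)
  MvPoly-Char≢2 char zero    = char
  MvPoly-Char≢2 char (suc m) .2≉0 (Polynomial.[ e ]) = MvPoly-Char≢2 char m .2≉0 (e 0)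

ℝ-Char≢2 : Char≢2 Real.ℝ-domain
ℝ-Char≢2 .2≉0 (Real.[ null ]) with Real.small null 1ℚ (ℚ.positive⁻¹ 1ℚ)
-- The representing sequence is constantly 2, hence never below the chosen bound 1.
... | N , lt = ℚ.<-asym (lt N ℕ.≤-refl) (from-yes (1ℚ ℚ.<? ℚ.∣ (1ℚ ℚ.+ 1ℚ) ℚ.- 0ℚ ∣))

-- Clearing denominators

module _ (R : IntegralDomain) where
  private
    module R = IntegralDomain R
    module F = FractionField R
    module 𝔽 = CommutativeRing F.commutativeRing
    module ΣR = SemiringSum R.semiring
    module ΣF = SemiringSum 𝔽.semiring
    module LR = LinearAlgebra R.commutativeRing
    module LF = LinearAlgebra F.commutativeRing
    open F using (Fraction; _/_[_]; [_]; fromDomain)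
    open SemiringSolver R.commutativeSemiring using (solve; _:+_; _:*_; _:=_; con)

    fromDomain-cong : ∀ {a b} → a R.≈ b → fromDomain a 𝔽.≈ fromDomain b
    fromDomain-cong a≈b = [ R.*-congʳ a≈b ]

    fromDomain-injective : ∀ {a b} → fromDomain a 𝔽.≈ fromDomain b → a R.≈ b
    fromDomain-injective ([ e ]) = R.trans (R.sym (R.*-identityʳ _)) (R.trans e (R.*-identityʳ _))

    fromDomain-* : ∀ a b → fromDomain a 𝔽.* fromDomain b 𝔽.≈ fromDomain (a R.* b)
    fromDomain-* a b = [ R.*-congˡ {a R.* b} (R.sym (R.*-identityʳ R.1#)) ]

    fromDomain-+ : ∀ a b → fromDomain a 𝔽.+ fromDomain b 𝔽.≈ fromDomain (a R.+ b)
    fromDomain-+ a b = [ solve 2 (λ a b →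
      (a :* con 1 :+ b :* con 1) :* con 1 := (a :+ b) :* (con 1 :* con 1)) R.refl a b ]

    fromDomain-sum : ∀ {N} (f : Fin N → R.Carrier) → ΣF.sum (fromDomain ∘ f) 𝔽.≈ fromDomain (ΣR.sum f)
    fromDomain-sum {zero}  f = 𝔽.refl
    fromDomain-sum {suc N} f = 𝔽.trans
      (𝔽.+-congˡ {fromDomain (f zero)} (fromDomain-sum (f ∘ suc))) (fromDomain-+ (f zero) (ΣR.sum (f ∘ suc)))

    clearDenominators : ∀ {N} (c : Fin N → Fraction) →
      Σ[ d ∈ R.Carrier ] ¬ d R.≈ R.0# ×
        Σ[ b ∈ (Fin N → R.Carrier) ] (∀ (e : Fin N) → fromDomain d 𝔽.* c e 𝔽.≈ fromDomain (b e))
    clearDenominators {zero}  c = R.1# , R.1≉0 , (λ _ → R.0#) , λ ()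
    clearDenominators {suc N} c with c zero in c₀≡ | clearDenominators (c ∘ suc)
    ... | p / q [ q≉0 ] | d , d≉0 , b , db =
      -- The common denominator `d` of the tail is multiplied by the new one: `q` cancels against
      -- the head, and the tail numerators pick up `q`.
      d R.* q , R.*-≉0 d≉0 q≉0 , (λ { zero → d R.* p ; (suc e) → q R.* b e }) , λ
        { zero    → ≡.subst (λ x → fromDomain (d R.* q) 𝔽.* x 𝔽.≈ fromDomain (d R.* p)) (≡.sym c₀≡)
            [ solve 3 (λ d p q → ((d :* q) :* p) :* con 1 := (d :* p) :* (con 1 :* q)) R.refl d p q ]
        ; (suc e) → step (c (suc e)) (b e) (db e)
        }
      where
      step : ∀ x a → fromDomain d 𝔽.* x 𝔽.≈ fromDomain a →
             fromDomain (d R.* q) 𝔽.* x 𝔽.≈ fromDomain (q R.* a)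
      step (u / v [ _ ]) a ([ e ]) = [ (begin
        ((d R.* q) R.* u) R.* R.1#  ≈⟨ solve 3 (λ d q u → ((d :* q) :* u) :* con 1 := q :* ((d :* u) :* con 1)) R.refl d q u ⟩
        q R.* ((d R.* u) R.* R.1#)  ≈⟨ R.*-congˡ e ⟩
        q R.* (a R.* (R.1# R.* v))  ≈⟨ R.*-assoc q a _ ⟨
        (q R.* a) R.* (R.1# R.* v)  ∎) ]
        where open SetoidReasoning R.setoid

    scale-injective : ∀ {d} → ¬ d R.≈ R.0# → ∀ x → fromDomain d 𝔽.* x 𝔽.≈ 𝔽.0# → x 𝔽.≈ 𝔽.0#
    scale-injective {d} d≉0 (u / v [ _ ]) ([ e ]) = [ R.*-cancel d _ _ d≉0 (begin
      d R.* (u R.* R.1#)          ≈⟨ R.*-assoc d u _ ⟨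
      (d R.* u) R.* R.1#          ≈⟨ e ⟩
      R.0# R.* (R.1# R.* v)       ≈⟨ R.zeroˡ _ ⟩
      R.0#                        ≈⟨ R.zeroʳ d ⟨
      d R.* R.0#                  ≈⟨ R.*-congˡ (R.zeroˡ v) ⟨
      d R.* (R.0# R.* v)          ∎) ]
      where open SetoidReasoning R.setoid

  -- A relation with fraction coefficients becomes one over the domain after multiplication by a
  -- common denominator, and a nonzero scalar loses no information. In the other direction the
  -- domain embeds. No fractions are needed after this.
  fractions-independent⇔ : ∀ {m N} (A : Fin m → Fin N → R.Carrier) (S : Subset N) →
    LF.IndependentColumns (λ θ e → fromDomain (A θ e)) S ⇔ LR.IndependentColumns A S
  fractions-independent⇔ {m} {N} A S = mk⇔ to from
    where
    to : LF.IndependentColumns (λ θ e → fromDomain (A θ e)) S → LR.IndependentColumns A S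
    to ind c supp rows e = fromDomain-injective (ind (fromDomain ∘ c) (λ e e∉S → fromDomain-cong (supp e e∉S))
      (λ θ → begin
        ΣF.sum (λ e → fromDomain (c e) 𝔽.* fromDomain (A θ e))
          ≈⟨ ΣF.sum-cong-≋ (λ e → fromDomain-* (c e) (A θ e)) ⟩
        ΣF.sum (λ e → fromDomain (c e R.* A θ e))
          ≈⟨ fromDomain-sum (λ e → c e R.* A θ e) ⟩
        fromDomain (ΣR.sum (λ e → c e R.* A θ e))
          ≈⟨ fromDomain-cong (rows θ) ⟩
        𝔽.0# ∎) e)
      where open SetoidReasoning 𝔽.setoid
    from : LR.IndependentColumns A S → LF.IndependentColumns (λ θ e → fromDomain (A θ e)) S
    from ind c supp rows e with clearDenominators c
    ... | d , d≉0 , b , db = scale-injective d≉0 (c e) (begin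
        fromDomain d 𝔽.* c e  ≈⟨ db e ⟩
        fromDomain (b e)      ≈⟨ fromDomain-cong (ind b b-supp b-rows e) ⟩
        𝔽.0#                  ∎)
      where
      open SetoidReasoning 𝔽.setoid
      b-supp : ∀ e → e ∉ S → b e R.≈ R.0#
      b-supp e e∉S = fromDomain-injective (begin
        fromDomain (b e)       ≈⟨ db e ⟨
        fromDomain d 𝔽.* c e   ≈⟨ 𝔽.*-congˡ {fromDomain d} {c e} {𝔽.0#} (supp e e∉S) ⟩
        fromDomain d 𝔽.* 𝔽.0#  ≈⟨ 𝔽.zeroʳ (fromDomain d) ⟩
        𝔽.0#                   ∎)
      scaled : ∀ θ e → fromDomain (b e R.* A θ e) 𝔽.≈ fromDomain d 𝔽.* (c e 𝔽.* fromDomain (A θ e))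
      scaled θ e = begin
        fromDomain (b e R.* A θ e)
          ≈⟨ fromDomain-* (b e) (A θ e) ⟨
        fromDomain (b e) 𝔽.* fromDomain (A θ e)
          ≈⟨ 𝔽.*-congʳ {fromDomain (A θ e)} {fromDomain d 𝔽.* c e} {fromDomain (b e)} (db e) ⟨
        (fromDomain d 𝔽.* c e) 𝔽.* fromDomain (A θ e)
          ≈⟨ 𝔽.*-assoc (fromDomain d) (c e) (fromDomain (A θ e)) ⟩
        fromDomain d 𝔽.* (c e 𝔽.* fromDomain (A θ e)) ∎
      b-rows : ∀ θ → ΣR.sum (λ e → b e R.* A θ e) R.≈ R.0#
      b-rows θ = fromDomain-injective (begin
        fromDomain (ΣR.sum (λ e → b e R.* A θ e))
          ≈⟨ fromDomain-sum (λ e → b e R.* A θ e) ⟨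
        ΣF.sum (λ e → fromDomain (b e R.* A θ e))
          ≈⟨ ΣF.sum-cong-≋ (scaled θ) ⟩
        ΣF.sum (λ e → fromDomain d 𝔽.* (c e 𝔽.* fromDomain (A θ e)))
          ≈⟨ ΣF.*-distribˡ-sum (fromDomain d) (λ e → c e 𝔽.* fromDomain (A θ e)) ⟨
        fromDomain d 𝔽.* ΣF.sum (λ e → c e 𝔽.* fromDomain (A θ e))
          ≈⟨ 𝔽.*-congˡ {fromDomain d} {ΣF.sum (λ e → c e 𝔽.* fromDomain (A θ e))} {𝔽.0#} (rows θ) ⟩
        fromDomain d 𝔽.* 𝔽.0#
          ≈⟨ 𝔽.zeroʳ (fromDomain d) ⟩
        𝔽.0# ∎)

-- Positions of the symmetric matrix and edge variables

Unique-lookup-injective : ∀ {A : Set} {xs : List A} → Unique xs →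
  ∀ i j → lookup xs i ≡ lookup xs j → i ≡ j
Unique-lookup-injective (x∉xs ∷ u) zero    zero    eq = ≡.refl
Unique-lookup-injective (x∉xs ∷ u) zero    (suc j) eq = contradiction eq (All.lookup x∉xs (∈-lookup j))
Unique-lookup-injective (x∉xs ∷ u) (suc i) zero    eq = contradiction (≡.sym eq) (All.lookup x∉xs (∈-lookup i))
Unique-lookup-injective (x∉xs ∷ u) (suc i) (suc j) eq = ≡.cong suc (Unique-lookup-injective u i j eq)

infix 4 _~_
-- Equality of unordered pairs. The ground set stores only sorted pairs, whereas an edge may run
-- against the order of `Fin n`.
data _~_ {A : Set} : A × A → A × A → Set where
  same : ∀ {i j} → (i , j) ~ (i , j)
  swap : ∀ {i j} → (i , j) ~ (j , i)

~-trans : ∀ {A : Set} {p q r : A × A} → p ~ q → q ~ r → p ~ r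
~-trans same e    = e
~-trans swap same = swap
~-trans swap swap = same

~-sym : ∀ {A : Set} {p q : A × A} → p ~ q → q ~ p
~-sym same = same
~-sym swap = swap

module Positions (n : ℕ) where

  pair : Fin (#positions n) → Fin n × Fin n
  pair = lookup (positions n)

  private
    ordered : ∀ i j → i Fin.≤ j → ∃[ e ] pair e ≡ (i , j)
    ordered i j i≤j = index i,j∈ , ≡.sym (lookup-index i,j∈)
      where
      i,j∈ : (i , j) ∈ₗ positions n
      i,j∈ = ∈-filter⁺ (λ (i , j) → i Fin.≤? j) (∈-cartesianProduct⁺ (∈-allFin i) (∈-allFin j)) i≤j

    position : ∀ i j → ∃[ e ] pair e ~ (i , j)
    position i j with Fin.≤-total i j
    ... | inj₁ i≤j = map₂ (λ eq → ≡.subst (_~ (i , j)) (≡.sym eq) same) (ordered i j i≤j)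
    ... | inj₂ j≤i = map₂ (λ eq → ≡.subst (_~ (i , j)) (≡.sym eq) swap) (ordered j i j≤i)

  abstract
    -- Kept abstract so that the comparison of `i` with `j` never unfolds; `pair-pos` determines the
    -- position completely.
    pos : Fin n → Fin n → Fin (#positions n)
    pos i j = proj₁ (position i j)

    pair-pos : ∀ i j → pair (pos i j) ~ (i , j)
    pair-pos i j = proj₂ (position i j)

  private
    pair-sorted : ∀ e → uncurry Fin._≤_ (pair e)
    pair-sorted e = proj₂ (∈-filter⁻ (λ (i , j) → i Fin.≤? j)
      {xs = cartesianProduct (allFin n) (allFin n)} (∈-lookup {xs = positions n} e))

    pair-injective : ∀ e e′ → pair e ≡ pair e′ → e ≡ e′
    pair-injective = Unique-lookup-injective
      (Unique.filter⁺ _ (Unique.cartesianProduct⁺ (Unique.allFin⁺ n) (Unique.allFin⁺ n)))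

    sorted-~ : ∀ {p q : Fin n × Fin n} → p ~ q → uncurry Fin._≤_ p → uncurry Fin._≤_ q → p ≡ q
    sorted-~ same _   _   = ≡.refl
    sorted-~ swap i≤j j≤i with Fin.≤-antisym i≤j j≤i
    ... | ≡.refl = ≡.refl

  -- Antisymmetry makes a swap between two sorted pairs trivial, and the list of positions has no
  -- duplicates.
  pair-~-injective : ∀ {e e′} → pair e ~ pair e′ → e ≡ e′
  pair-~-injective {e} {e′} r = pair-injective e e′ (sorted-~ r (pair-sorted e) (pair-sorted e′))

  pos-unique : ∀ {e i j} → pair e ~ (i , j) → e ≡ pos i j
  pos-unique {e} {i} {j} r = pair-~-injective (~-trans r (~-sym (pair-pos i j)))

  pos-~ : ∀ {i j k l} → pos i j ≡ pos k l → (i , j) ~ (k , l)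
  pos-~ {i} {j} {k} {l} eq =
    ~-trans (~-sym (pair-pos i j)) (≡.subst (λ e → pair e ~ (k , l)) (≡.sym eq) (pair-pos k l))

module _ {n : ℕ} (G : Digraph n) where
  open Digraph G

  -- Looking up the index of an edge returns the edge. Hence different edges carry different
  -- indeterminates. The local `∈-edges` restates the membership proof hidden in the definition of
  -- `edgeIndex`.
  edgeIndex-injective : ∀ {i j k l} (h : i ⟶ j) (h′ : k ⟶ l) →
    edgeIndex h ≡ edgeIndex h′ → (i , j) ≡ (k , l)
  edgeIndex-injective h h′ eq = ≡.trans (lookup-index (∈-edges h))
    (≡.trans (≡.cong (lookup edges) eq) (≡.sym (lookup-index (∈-edges h′))))
    where
    ∈-edges : ∀ {i j} → i ⟶ j → (i , j) ∈ₗ edges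
    ∈-edges {i} {j} = ∈-filter⁺ (λ (i , j) → T? (D i j)) (∈-cartesianProduct⁺ (∈-allFin i) (∈-allFin j))

-- ∂[ θₛ ] and ∂[ θ h ] are the partial derivatives by s and by the entry of Λ at the edge h.
record Coordinates {n : ℕ} (G : Digraph n) : Set₁ where
  open Digraph G
  field
    domain : IntegralDomain
  open IntegralDomain domain
  field
    char≢2       : Char≢2 domain
    {#θ}         : ℕ
    ∂[_]         : Fin #θ → Carrier → Carrier
    isDerivation : ∀ θ → IsDerivation domain ∂[ θ ]
    s            : Carrier
    Λ            : Fin n → Fin n → Carrier
    θₛ           : Fin #θ
    θ            : ∀ {i j} → i ⟶ j → Fin #θ
    ∂ₛs          : ∂[ θₛ ] s ≈ 1#
    ∂ₛΛ          : ∀ i j → ∂[ θₛ ] (Λ i j) ≈ 0#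
    ∂s           : ∀ {i j} (h : i ⟶ j) → ∂[ θ h ] s ≈ 0#
    ∂Λ-self      : ∀ {i j} (h : i ⟶ j) → ∂[ θ h ] (Λ i j) ≈ 1#
    ∂Λ-other     : ∀ {i j} (h : i ⟶ j) k l → (i , j) ≢ (k , l) → ∂[ θ h ] (Λ k l) ≈ 0#
    Λ-nonEdge    : ∀ {i j} → ¬ i ⟶ j → Λ i j ≈ 0#

module _ {n : ℕ} (G : Digraph n) where
  open Digraph G
  private
    module P = Parametrization G
    open IntegralDomain P.ℝ[λ,s] using (Carrier; _≈_; 0#; 1#; refl)

    Λ-edge : ∀ {i j} (h : i ⟶ j) → P.Λ i j ≡ var {Real.ℝ-domain} {P.#indeterminates} (suc (edgeIndex h))
    Λ-edge {i} {j} h with T? (D i j)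
    ... | yes h′ = ≡.cong (λ h → var {Real.ℝ-domain} {P.#indeterminates} (suc (edgeIndex h))) (T-irrelevant h′ h)
    ... | no ¬h  = contradiction h ¬h

    Λ-nonEdge : ∀ {i j} → ¬ i ⟶ j → P.Λ i j ≈ 0#
    Λ-nonEdge {i} {j} ¬h with T? (D i j)
    ... | yes h = contradiction h ¬h
    ... | no _  = refl {0#}

    ∂′ : Fin P.#indeterminates → Carrier → Carrier
    ∂′ = ∂ {Real.ℝ-domain} {P.#indeterminates}

    module d i = IsDerivation (∂-isDerivation {Real.ℝ-domain} {P.#indeterminates} i)

    ∂Λ-vanishes : ∀ i k l → (∀ (h : k ⟶ l) → i ≢ suc (edgeIndex h)) → ∂′ i (P.Λ k l) ≈ 0#
    ∂Λ-vanishes i k l other with T? (D k l)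
    ... | yes h = ∂-var-other (other h)
    ... | no _  = d.0-homo i

    ∂ₛs : ∂′ zero P.s ≈ 1#
    ∂ₛs = ∂-var-self {Real.ℝ-domain} {P.#indeterminates} zero

    ∂ₛΛ : ∀ i j → ∂′ zero (P.Λ i j) ≈ 0#
    ∂ₛΛ i j = ∂Λ-vanishes zero i j λ _ ()

    ∂s : ∀ {i j} (h : i ⟶ j) → ∂′ (suc (edgeIndex h)) P.s ≈ 0#
    ∂s h = ∂-var-other {Real.ℝ-domain} {P.#indeterminates} {suc (edgeIndex h)} {zero} λ ()

    ∂Λ-self : ∀ {i j} (h : i ⟶ j) → ∂′ (suc (edgeIndex h)) (P.Λ i j) ≈ 1#
    ∂Λ-self h = ≡.subst (λ x → ∂′ (suc (edgeIndex h)) x ≈ 1#) (≡.sym (Λ-edge h))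
        (∂-var-self {Real.ℝ-domain} {P.#indeterminates} (suc (edgeIndex h)))

    ∂Λ-other : ∀ {i j} (h : i ⟶ j) k l → (i , j) ≢ (k , l) → ∂′ (suc (edgeIndex h)) (P.Λ k l) ≈ 0#
    ∂Λ-other h k l ≢ = ∂Λ-vanishes (suc (edgeIndex h)) k l
        λ h′ eq → ≢ (edgeIndex-injective G h h′ (Fin.suc-injective eq))

  coordinates : Coordinates G
  coordinates = record
    { domain       = P.ℝ[λ,s]
    ; char≢2       = MvPoly-Char≢2 ℝ-Char≢2 P.#indeterminates
    ; ∂[_]         = ∂′
    ; isDerivation = ∂-isDerivation
    ; s            = P.s
    ; Λ            = P.Λ
    ; θₛ           = zero
    ; θ            = λ h → suc (edgeIndex h)
    ; ∂ₛs          = ∂ₛs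
    ; ∂ₛΛ          = ∂ₛΛ
    ; ∂s           = ∂s
    ; ∂Λ-self      = ∂Λ-self
    ; ∂Λ-other     = ∂Λ-other
    ; Λ-nonEdge    = Λ-nonEdge
    }

-- Columns of the Jacobian

module _ {n : ℕ} (G : Digraph n) where
  open Digraph G

  edge? : ∀ i j → Dec (i ⟶ j)
  edge? i j = T? (D i j)

  adjacent? : ∀ i j → Dec (Adjacent i j)
  adjacent? i j = edge? i j ⊎-dec edge? j i

  ¬i⟶i : ∀ {i} → ¬ i ⟶ i
  ¬i⟶i {i} = ≡.subst T (noLoop i)

  ⟶⇒≢ : ∀ {i j} → i ⟶ j → i ≢ j
  ⟶⇒≢ h ≡.refl = ¬i⟶i h

  -- The diagonal position of `l` and the edges leaving `l`, that is, the positions where `f l` can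
  -- be nonzero.
  Star : Fin n → Fin n × Fin n → Set
  Star l p = ∃[ k ] (k ≡ l ⊎ l ⟶ k) × p ~ (l , k)

  CommonChild : Fin n → Fin n → Set
  CommonChild i j = ∃[ k ] i ⟶ k × j ⟶ k

module Columns {n : ℕ} (G : Digraph n) (C : Coordinates G)
  (simple : Digraph.Simple G) (triangleFree : Digraph.TransitiveTriangleFree G) where

  open Digraph G
  open Positions n
  open Coordinates C
  open IntegralDomain domain hiding (zero)
  open LinearAlgebra commutativeRing
  open SemiringSum semiring
    using (sum; sum-cong-≋; sum-replicate-zero; ∑-distrib-+; ∑-comm; *-distribˡ-sum; *-distribʳ-sum)
  open RingProperties ring using (-‿distribˡ-*; -‿distribʳ-*; -0#≈0#; -‿involutive; -‿+-comm)
  open SemiringSolver commutativeSemiring using (solve; _:+_; _:*_; _:=_; con)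
  open SetoidReasoning setoid

  private
    module ∂ t = IsDerivation (isDerivation t)

  -- Written exactly like `ψ`, so that at `coordinates G` the matrix `J` below is the given Jacobian
  -- by definition.
  K : Matrix n n
  K = s ⊙ ((I ⊖ Λ) ⊗ (I ⊖ Λ) ᵀ)

  J : Fin #θ → Fin (#positions n) → Carrier
  J t e = ∂[ t ] (uncurry K (pair e))

  row : Fin #θ → (Fin (#positions n) → Carrier) → Carrier
  row t c = sum λ e → c e * J t e

  -- Independence over the polynomial ring, with the set of columns given by a predicate on node
  -- pairs instead of a Boolean vector over positions.
  Independent : (Fin n × Fin n → Set) → Set
  Independent Q = ∀ c → (∀ e → ¬ Q (pair e) → c e ≈ 0#) → (∀ t → row t c ≈ 0#) → ∀ e → c e ≈ 0#

  -- Entries of `K` and the combinations `f`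

  private
    cancel : ∀ {x y} → ¬ y ≈ 0# → x * y ≈ 0# → x ≈ 0#
    cancel {x} {y} y≉0 xy≈0 =
      *-cancel y x 0# y≉0 (trans (*-comm y x) (trans xy≈0 (sym (zeroʳ y))))

    -≉0 : ∀ {x} → ¬ x ≈ 0# → ¬ - x ≈ 0#
    -≉0 x≉0 -x≈0 = x≉0 (trans (sym (-‿involutive _)) (trans (-‿cong -x≈0) -0#≈0#))

    x+x≉0 : ∀ {x} → ¬ x ≈ 0# → ¬ x + x ≈ 0#
    x+x≉0 {x} x≉0 2x≈0 = *-≉0 (2≉0 char≢2) x≉0 (trans (solve 1 (λ x → (con 1 :+ con 1) :* x := x :+ x) refl x) 2x≈0)

    sum-0 : ∀ {m} (f : Fin m → Carrier) → (∀ i → f i ≈ 0#) → sum f ≈ 0#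
    sum-0 {m} f f≈0 = trans (sum-cong-≋ f≈0) (sum-replicate-zero m)

    sum-single : ∀ {m} (i : Fin m) (f : Fin m → Carrier) → (∀ j → j ≢ i → f j ≈ 0#) → sum f ≈ f i
    sum-single zero    f f≈0 = trans (+-congˡ (sum-0 (f ∘ suc) (λ j → f≈0 (suc j) λ ()))) (+-identityʳ _)
    sum-single (suc i) f f≈0 = trans
      (+-cong (f≈0 zero λ ()) (sum-single i (f ∘ suc) (λ j j≢i → f≈0 (suc j) (j≢i ∘ Fin.suc-injective))))
      (+-identityˡ _)

    I-self : ∀ {m} (i : Fin m) → I i i ≈ 1#
    I-self i with i Fin.≟ i
    ... | yes _  = refl
    ... | no i≢i = contradiction ≡.refl i≢i

    I-other : ∀ {m} (i j : Fin m) → i ≢ j → I i j ≈ 0#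
    I-other i j i≢j with i Fin.≟ j
    ... | yes i≡j = contradiction i≡j i≢j
    ... | no _    = refl

    sum-I : ∀ {m} (i : Fin m) (g : Fin m → Carrier) → sum (λ k → I i k * g k) ≈ g i
    sum-I i g = trans
      (sum-single i _ (λ k k≢i → trans (*-congʳ (I-other _ _ (k≢i ∘ ≡.sym))) (zeroˡ _)))
      (trans (*-congʳ (I-self i)) (*-identityˡ _))

    -*- : ∀ x y → (- x) * (- y) ≈ x * y
    -*- x y = trans (sym (-‿distribˡ-* x (- y)))
      (trans (-‿cong (sym (-‿distribʳ-* x y))) (-‿involutive _))

    K-expand : ∀ i j → K i j ≈ s * ((I j i + - Λ j i) + (- Λ i j + sum λ k → Λ i k * Λ j k))
    K-expand i j = *-congˡ (begin
      sum (λ k → (I i k - Λ i k) * (I j k - Λ j k))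
        ≈⟨ sum-cong-≋ (λ k → trans
             (solve 4 (λ a b c d → (a :+ b) :* (c :+ d) := a :* (c :+ d) :+ (c :* b :+ b :* d)) refl
                (I i k) (- Λ i k) (I j k) (- Λ j k))
             (+-congˡ (+-congˡ (-*- (Λ i k) (Λ j k))))) ⟩
      sum (λ k → I i k * (I j k - Λ j k) + (I j k * (- Λ i k) + Λ i k * Λ j k))
        ≈⟨ trans (∑-distrib-+ {n} (λ k → I i k * (I j k - Λ j k)) _)
             (+-congˡ (∑-distrib-+ {n} (λ k → I j k * (- Λ i k)) (λ k → Λ i k * Λ j k))) ⟩
      sum (λ k → I i k * (I j k - Λ j k)) + (sum (λ k → I j k * (- Λ i k)) + sum λ k → Λ i k * Λ j k)
        ≈⟨ +-cong (sum-I i (λ k → I j k - Λ j k)) (+-congʳ (sum-I j (λ k → - Λ i k))) ⟩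
      (I j i + - Λ j i) + (- Λ i j + sum λ k → Λ i k * Λ j k) ∎)

    K-sym : ∀ i j → K i j ≈ K j i
    K-sym i j = *-congˡ (sum-cong-≋ (λ k → *-comm (I i k - Λ i k) (I j k - Λ j k)))

    -Λ-nonEdge : ∀ {i j} → ¬ i ⟶ j → - Λ i j ≈ 0#
    -Λ-nonEdge ¬h = trans (-‿cong (Λ-nonEdge ¬h)) -0#≈0#

    ΛΛ-vanishes : ∀ i j k → ¬ (i ⟶ k × j ⟶ k) → Λ i k * Λ j k ≈ 0#
    ΛΛ-vanishes i j k ¬both with edge? G i k | edge? G j k
    ... | yes h | yes h′ = contradiction (h , h′) ¬both
    ... | no ¬h | _      = trans (*-congʳ (Λ-nonEdge ¬h)) (zeroˡ _)
    ... | _     | no ¬h  = trans (*-congˡ (Λ-nonEdge ¬h)) (zeroʳ _)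

    -- Simplicity removes the term of the reverse edge. A common child of `i` and `j` would form a
    -- transitive triangle with them, so the quadratic sum is zero.
    K-edge : ∀ {i j} → i ⟶ j → K i j ≈ - (s * Λ i j)
    K-edge {i} {j} h = begin
      K i j
        ≈⟨ K-expand i j ⟩
      s * ((I j i + - Λ j i) + (- Λ i j + sum λ k → Λ i k * Λ j k))
        ≈⟨ *-congˡ (+-cong (+-cong (I-other _ _ (⟶⇒≢ G h ∘ ≡.sym)) (-Λ-nonEdge (λ h′ → simple i j (h , h′))))
             (+-congˡ (sum-0 _ (λ k → ΛΛ-vanishes i j k
               (λ (i⟶k , j⟶k) → triangleFree i j k (i⟶k , j⟶k , inj₁ h)))))) ⟩
      s * ((0# + 0#) + (- Λ i j + 0#))
        ≈⟨ solve 2 (λ s x → s :* ((con 0 :+ con 0) :+ (x :+ con 0)) := s :* x) refl s (- Λ i j) ⟩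
      s * (- Λ i j)
        ≈⟨ -‿distribʳ-* s (Λ i j) ⟨
      - (s * Λ i j) ∎

    σ : Fin n → Carrier
    σ l = sum λ k → Λ l k * Λ l k

    K-diagonal : ∀ l → K l l ≈ s * (1# + σ l)
    K-diagonal l = begin
      K l l                                         ≈⟨ K-expand l l ⟩
      s * ((I l l + - Λ l l) + (- Λ l l + σ l))     ≈⟨ *-congˡ (+-cong
        (+-cong (I-self l) (-Λ-nonEdge (¬i⟶i G))) (+-congʳ (-Λ-nonEdge (¬i⟶i G)))) ⟩
      s * ((1# + 0#) + (0# + σ l))                  ≈⟨ *-congˡ (+-cong (+-identityʳ _) (+-identityˡ _)) ⟩
      s * (1# + σ l)                                ∎

    K-nonAdjacent : ∀ {i j} → i ≢ j → ¬ Adjacent i j → K i j ≈ s * sum λ k → Λ i k * Λ j k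
    K-nonAdjacent {i} {j} i≢j ¬adj = begin
      K i j
        ≈⟨ K-expand i j ⟩
      s * ((I j i + - Λ j i) + (- Λ i j + sum λ k → Λ i k * Λ j k))
        ≈⟨ *-congˡ (+-cong (+-cong (I-other _ _ (i≢j ∘ ≡.sym)) (-Λ-nonEdge (¬adj ∘ inj₂)))
             (+-congʳ (-Λ-nonEdge (¬adj ∘ inj₁)))) ⟩
      s * ((0# + 0#) + (0# + sum λ k → Λ i k * Λ j k))
        ≈⟨ *-congˡ (trans (+-cong (+-identityˡ _) (+-identityˡ _)) (+-identityˡ _)) ⟩
      s * (sum λ k → Λ i k * Λ j k) ∎

    -- Apart from `s`, the entry involves only rows `i` and `j` of `Λ`, so only variables of edges
    -- leaving `i` or `j`.
    ∂K-vanishes : ∀ t i j → ∂[ t ] s ≈ 0# → (∀ k → ∂[ t ] (Λ i k) ≈ 0#) → (∀ k → ∂[ t ] (Λ j k) ≈ 0#) →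
                  ∂[ t ] (K i j) ≈ 0#
    ∂K-vanishes t i j ∂s≈0 ∂Λi≈0 ∂Λj≈0 = ∂.*-vanishes t ∂s≈0
      (trans (∂.sum-homo t {n} _) (sum-0 _ (λ k → ∂.*-vanishes t (entry i k (∂Λi≈0 k)) (entry j k (∂Λj≈0 k)))))
      where
      ∂I : ∀ i k → ∂[ t ] (I {n} i k) ≈ 0#
      ∂I i k with i Fin.≟ k
      ... | yes _ = ∂.1-vanishes t
      ... | no _  = ∂.0-homo t
      entry : ∀ i k → ∂[ t ] (Λ i k) ≈ 0# → ∂[ t ] (I i k - Λ i k) ≈ 0#
      entry i k e = begin
        ∂[ t ] (I i k - Λ i k)               ≈⟨ ∂.+-homo t _ _ ⟩
        ∂[ t ] (I i k) + ∂[ t ] (- Λ i k)    ≈⟨ +-cong (∂I i k) (trans (∂.-‿homo t _) (-‿cong e)) ⟩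
        0# + - 0#                            ≈⟨ trans (+-identityˡ _) -0#≈0# ⟩
        0#                                   ∎

    J-~ : ∀ t {e i j} → pair e ~ (i , j) → J t e ≈ ∂[ t ] (K i j)
    J-~ t {e} r with pair e | r
    ... | _ | same = refl
    ... | _ | swap = ∂.cong t (K-sym _ _)

    J-pos : ∀ t i j → J t (pos i j) ≈ ∂[ t ] (K i j)
    J-pos t i j = J-~ t (pair-pos i j)

    row-cong : ∀ t {c c′} → (∀ e → c e ≈ c′ e) → row t c ≈ row t c′
    row-cong t c≈c′ = sum-cong-≋ (λ e → *-congʳ (c≈c′ e))

    row-+ : ∀ t c c′ → row t (λ e → c e + c′ e) ≈ row t c + row t c′
    row-+ t c c′ = trans (sum-cong-≋ (λ e → distribʳ (J t e) (c e) (c′ e))) (∑-distrib-+ (λ e → c e * J t e) _)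

    row-* : ∀ t x c → row t (λ e → x * c e) ≈ x * row t c
    row-* t x c = trans (sum-cong-≋ (λ e → *-assoc x (c e) (J t e))) (sym (*-distribˡ-sum x (λ e → c e * J t e)))

    row-combination : ∀ t x c y c′ → row t (λ e → x * c e + y * c′ e) ≈ x * row t c + y * row t c′
    row-combination t x c y c′ = trans (row-+ t (λ e → x * c e) (λ e → y * c′ e))
      (+-cong (row-* t x c) (row-* t y c′))

    row-unit : ∀ t i j → row t (I (pos i j)) ≈ ∂[ t ] (K i j)
    row-unit t i j = trans (sum-I (pos i j) (J t)) (J-pos t i j)

    -- In differentials, f l is dK_ll + 2 Σ_k λ_lk dK_lk. As K_ll = s (1 + Σ_k λ_lk²) and
    -- K_lk = - s λ_lk on edges, all dλ cancel and (1 - Σ_k λ_lk²) ds remains.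
    f : Fin n → Fin (#positions n) → Carrier
    f l e = I (pos l l) e + sum λ k → (Λ l k + Λ l k) * I (pos l k) e

    w : Fin n → Carrier
    w l = 1# - σ l

    row-f : ∀ t l → row t (f l) ≈ w l * ∂[ t ] s
    row-f t l = begin
      row t (f l)
        ≈⟨ row-+ t (I (pos l l)) _ ⟩
      row t (I (pos l l)) + sum (λ e → sum (λ k → (Λ l k + Λ l k) * I (pos l k) e) * J t e)
        ≈⟨ +-cong (trans (row-unit t l l) (trans (∂.cong t (trans (K-diagonal l) expand)) (∂.+-homo t _ _))) (begin
             sum (λ e → sum (λ k → (Λ l k + Λ l k) * I (pos l k) e) * J t e)
               ≈⟨ sum-cong-≋ (λ e → *-distribʳ-sum (J t e) (λ k → (Λ l k + Λ l k) * I (pos l k) e)) ⟩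
             sum (λ e → sum (λ k → ((Λ l k + Λ l k) * I (pos l k) e) * J t e))
               ≈⟨ ∑-comm {#positions n} {n} (λ e k → ((Λ l k + Λ l k) * I (pos l k) e) * J t e) ⟩
             sum (λ k → row t (λ e → (Λ l k + Λ l k) * I (pos l k) e))
               ≈⟨ sum-cong-≋ (λ k → trans (row-* t _ (I (pos l k))) (*-congˡ (row-unit t l k))) ⟩
             sum (λ k → (Λ l k + Λ l k) * ∂[ t ] (K l k)) ∎) ⟩
      (∂[ t ] s + ∂[ t ] (sum λ k → s * (Λ l k * Λ l k))) + sum (λ k → (Λ l k + Λ l k) * ∂[ t ] (K l k))
        ≈⟨ +-assoc _ _ _ ⟩
      ∂[ t ] s + (∂[ t ] (sum λ k → s * (Λ l k * Λ l k)) + sum (λ k → (Λ l k + Λ l k) * ∂[ t ] (K l k)))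
        ≈⟨ +-congˡ (trans (+-congʳ (∂.sum-homo t {n} _)) (sym (∑-distrib-+ {n} _ _))) ⟩
      ∂[ t ] s + sum (λ k → ∂[ t ] (s * (Λ l k * Λ l k)) + (Λ l k + Λ l k) * ∂[ t ] (K l k))
        ≈⟨ +-congˡ (trans (sum-cong-≋ cancellation) (sym (*-distribˡ-sum (- ∂[ t ] s) (λ k → Λ l k * Λ l k)))) ⟩
      ∂[ t ] s + (- ∂[ t ] s) * σ l
        ≈⟨ +-cong (sym (*-identityˡ _)) (trans (trans (sym (-‿distribˡ-* _ _)) (-‿cong (*-comm _ _))) (-‿distribˡ-* _ _)) ⟩
      1# * ∂[ t ] s + (- σ l) * ∂[ t ] s
        ≈⟨ distribʳ _ _ _ ⟨
      w l * ∂[ t ] s ∎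
      where
      expand : s * (1# + σ l) ≈ s + sum λ k → s * (Λ l k * Λ l k)
      expand = trans (distribˡ s 1# (σ l)) (+-cong (*-identityʳ s) (*-distribˡ-sum s (λ k → Λ l k * Λ l k)))
      -- Turns an identity without signs, as the semiring solver proves it, into the signed one.
      subtract : ∀ {u v g} → u + v ≈ g → u + - g ≈ - v
      subtract {u} {v} {g} e = begin
        u + - g              ≈⟨ +-congˡ (-‿cong e) ⟨
        u + - (u + v)        ≈⟨ +-congˡ (-‿+-comm u v) ⟨
        u + (- u + - v)      ≈⟨ +-assoc _ _ _ ⟨
        (u + - u) + - v      ≈⟨ trans (+-congʳ (-‿inverseʳ u)) (+-identityˡ _) ⟩
        - v                  ∎
      -- On an edge, with x = λ_lk: d(s x²) - 2x d(s x) = x² ds + 2 s x dx - 2 x² ds - 2 s x dx = -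
      -- x² ds. Off the edges both sides are zero.
      cancellation : ∀ k → ∂[ t ] (s * (Λ l k * Λ l k)) + (Λ l k + Λ l k) * ∂[ t ] (K l k) ≈ (- ∂[ t ] s) * (Λ l k * Λ l k)
      cancellation k with edge? G l k
      ... | no ¬h = begin
        ∂[ t ] (s * (Λ l k * Λ l k)) + (Λ l k + Λ l k) * ∂[ t ] (K l k)
          ≈⟨ +-cong (trans (∂.cong t (trans (*-congˡ ΛΛ≈0) (zeroʳ s))) (∂.0-homo t))
               (trans (*-congʳ (trans (+-cong (Λ-nonEdge ¬h) (Λ-nonEdge ¬h)) (+-identityˡ 0#))) (zeroˡ _)) ⟩
        0# + 0#
          ≈⟨ +-identityˡ 0# ⟩
        0#
          ≈⟨ trans (*-congˡ ΛΛ≈0) (zeroʳ _) ⟨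
        (- ∂[ t ] s) * (Λ l k * Λ l k) ∎
        where
        ΛΛ≈0 : Λ l k * Λ l k ≈ 0#
        ΛΛ≈0 = trans (*-congʳ (Λ-nonEdge ¬h)) (zeroˡ _)
      ... | yes h = begin
        ∂[ t ] (s * (x * x)) + (x + x) * ∂[ t ] (K l k)
          ≈⟨ +-cong (trans (∂.leibniz t _ _) (+-congˡ (*-congˡ (∂.leibniz t _ _))))
               (trans (*-congˡ (trans (∂.cong t (K-edge h)) (trans (∂.-‿homo t _) (-‿cong (∂.leibniz t _ _)))))
                 (sym (-‿distribʳ-* _ _))) ⟩
        (a * (x * x) + s * (y * x + x * y)) + - ((x + x) * (a * x + s * y))
          ≈⟨ subtract (solve 4 (λ a s x y → (a :* (x :* x) :+ s :* (y :* x :+ x :* y)) :+ a :* (x :* x) :=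
               (x :+ x) :* (a :* x :+ s :* y)) refl a s x y) ⟩
        - (a * (x * x))
          ≈⟨ -‿distribˡ-* _ _ ⟩
        (- a) * (x * x) ∎
        where
        a = ∂[ t ] s
        x = Λ l k
        y = ∂[ t ] x

    s≉0 : ¬ s ≈ 0#
    s≉0 s≈0 = 1≉0 (trans (sym ∂ₛs) (trans (∂.cong θₛ s≈0) (∂.0-homo θₛ)))

    -- Zero has derivative 0, but this entry has derivative 1 by its own variable.
    Λ≉0 : ∀ {i j} → i ⟶ j → ¬ Λ i j ≈ 0#
    Λ≉0 h Λ≈0 = 1≉0 (trans (sym (∂Λ-self h)) (trans (∂.cong (θ h) Λ≈0) (∂.0-homo (θ h))))

    ∂Λ² : ∀ {i j} (h : i ⟶ j) → ∂[ θ h ] (Λ i j * Λ i j) ≈ Λ i j + Λ i j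
    ∂Λ² h = trans (∂.leibniz (θ h) _ _) (+-cong (trans (*-congʳ (∂Λ-self h)) (*-identityˡ _))
      (trans (*-congˡ (∂Λ-self h)) (*-identityʳ _)))

    -- If `l` has a child `k`, differentiating `σ l ≈ 1#` by λ_lk would give 2 λ_lk = 0. If `l` has
    -- none, `σ l` is zero and `w l` equals 1.
    w≉0 : ∀ l → ¬ w l ≈ 0#
    w≉0 l w≈0 with Fin.any? (λ k → edge? G l k)
    ... | yes (k , h) = x+x≉0 (Λ≉0 h) (begin
        Λ l k + Λ l k                               ≈⟨ ∂Λ² h ⟨
        ∂[ θ h ] (Λ l k * Λ l k)                    ≈⟨ sum-single k _ (λ j j≢k →
          ∂.*-vanishes (θ h) (∂Λ-other h l j (λ { ≡.refl → j≢k ≡.refl })) (∂Λ-other h l j (λ { ≡.refl → j≢k ≡.refl }))) ⟨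
        sum (λ j → ∂[ θ h ] (Λ l j * Λ l j))        ≈⟨ ∂.sum-homo (θ h) {n} _ ⟨
        ∂[ θ h ] (σ l)                              ≈⟨ ∂.cong (θ h) σ≈1 ⟩
        ∂[ θ h ] 1#                                 ≈⟨ ∂.1-vanishes (θ h) ⟩
        0#                                          ∎)
      where
      σ≈1 : σ l ≈ 1#
      σ≈1 = sym (RingProperties.x∙y⁻¹≈ε⇒x≈y ring 1# (σ l) w≈0)
    ... | no none = 1≉0 (begin
        1#         ≈⟨ RingProperties.x∙y⁻¹≈ε⇒x≈y ring 1# (σ l) w≈0 ⟩
        σ l        ≈⟨ sum-0 _ (λ k → trans (*-congʳ (Λ-nonEdge (λ h → none (k , h)))) (zeroˡ _)) ⟩
        0#         ∎)

    f-vanishes : ∀ l e → (∀ k → k ≡ l ⊎ l ⟶ k → e ≢ pos l k) → f l e ≈ 0#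
    f-vanishes l e avoids = trans (+-cong (I-other _ _ (avoids l (inj₁ ≡.refl) ∘ ≡.sym)) (sum-0 _ term)) (+-identityˡ 0#)
      where
      term : ∀ k → (Λ l k + Λ l k) * I (pos l k) e ≈ 0#
      term k with edge? G l k
      ... | yes h = trans (*-congˡ (I-other _ _ (avoids k (inj₂ h) ∘ ≡.sym))) (zeroʳ _)
      ... | no ¬h = trans (*-congʳ (trans (+-cong (Λ-nonEdge ¬h) (Λ-nonEdge ¬h)) (+-identityˡ 0#))) (zeroˡ _)

    f-at : ∀ l m → f l (pos l m) ≈ I (pos l l) (pos l m) + (Λ l m + Λ l m)
    f-at l m = +-congˡ (trans
      (sum-single m _ (λ k k≢m → trans (*-congˡ (I-other _ _ (λ eq → k≢m (second (pos-~ eq))))) (zeroʳ _)))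
      (trans (*-congˡ (I-self (pos l m))) (*-identityʳ _)))
      where
      second : ∀ {k m} → (l , k) ~ (l , m) → k ≡ m
      second same = ≡.refl
      second swap = ≡.refl

    f-self : ∀ l → f l (pos l l) ≈ 1#
    f-self l = trans (f-at l l) (trans (+-cong (I-self (pos l l))
      (trans (+-cong (Λ-nonEdge (¬i⟶i G)) (Λ-nonEdge (¬i⟶i G))) (+-identityˡ 0#))) (+-identityʳ 1#))

    f-edge : ∀ {l m} → l ⟶ m → f l (pos l m) ≈ Λ l m + Λ l m
    f-edge {l} {m} h = trans (f-at l m) (trans (+-congʳ (I-other _ _ (λ eq → distinct (pos-~ eq)))) (+-identityˡ _))
      where
      distinct : ¬ (l , l) ~ (l , m)
      distinct same = ¬i⟶i G h
      distinct swap = ¬i⟶i G h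

    f-away : ∀ {l i j} → l ≢ i → l ≢ j → f l (pos i j) ≈ 0#
    f-away {l} {i} {j} l≢i l≢j = f-vanishes l (pos i j) (λ k _ eq → distinct (pos-~ eq))
      where
      distinct : ∀ {k} → ¬ (i , j) ~ (l , k)
      distinct same = l≢i ≡.refl
      distinct swap = l≢j ≡.refl

    -- Edge positions against the edge rows of the Jacobian

    ∂K-otherEdge : ∀ {i j k l} (h : i ⟶ j) → k ⟶ l → (i , j) ≢ (k , l) → ∂[ θ h ] (K k l) ≈ 0#
    ∂K-otherEdge {k = k} {l} h h′ ≢ = begin
      ∂[ θ h ] (K k l)          ≈⟨ ∂.cong (θ h) (K-edge h′) ⟩
      ∂[ θ h ] (- (s * Λ k l))  ≈⟨ ∂.-‿homo (θ h) _ ⟩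
      - ∂[ θ h ] (s * Λ k l)    ≈⟨ -‿cong (∂.*-vanishes (θ h) (∂s h) (∂Λ-other h k l ≢)) ⟩
      - 0#                      ≈⟨ -0#≈0# ⟩
      0#                        ∎

    ∂K-edge : ∀ {i j} (h : i ⟶ j) → ∂[ θ h ] (K i j) ≈ - s
    ∂K-edge {i} {j} h = begin
      ∂[ θ h ] (K i j)                                     ≈⟨ ∂.cong (θ h) (K-edge h) ⟩
      ∂[ θ h ] (- (s * Λ i j))                             ≈⟨ ∂.-‿homo (θ h) _ ⟩
      - ∂[ θ h ] (s * Λ i j)                               ≈⟨ -‿cong (∂.leibniz (θ h) _ _) ⟩
      - (∂[ θ h ] s * Λ i j + s * ∂[ θ h ] (Λ i j))        ≈⟨ -‿cong (+-cong
        (trans (*-congʳ (∂s h)) (zeroˡ _)) (trans (*-congˡ (∂Λ-self h)) (*-identityʳ s))) ⟩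
      - (0# + s)                                           ≈⟨ -‿cong (+-identityˡ s) ⟩
      - s                                                  ∎

    coefficient-vanishes : ∀ t i j {c} → ¬ ∂[ t ] (K i j) ≈ 0# →
      (∀ e → e ≢ pos i j → c e * J t e ≈ 0#) → row t c ≈ 0# → c (pos i j) ≈ 0#
    coefficient-vanishes t i j ∂K≉0 others row≈0 =
      cancel ∂K≉0 (trans (*-congˡ (sym (J-pos t i j))) (trans (sym (sum-single (pos i j) _ others)) row≈0))

    edge-coefficient-vanishes : ∀ {i j} (h : i ⟶ j) {c} → (∀ e → ¬ uncurry Adjacent (pair e) → c e ≈ 0#) →
      row (θ h) c ≈ 0# → c (pos i j) ≈ 0#
    edge-coefficient-vanishes {i} {j} h {c} supp =
      coefficient-vanishes (θ h) i j (λ e → -≉0 s≉0 (trans (sym (∂K-edge h)) e)) others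
      where
      others : ∀ e → e ≢ pos i j → c e * J (θ h) e ≈ 0#
      others e e≢ with uncurry (adjacent? G) (pair e)
      ... | no ¬adj      = trans (*-congʳ (supp e ¬adj)) (zeroˡ _)
      ... | yes (inj₁ g) = trans (*-congˡ (∂K-otherEdge h g
        (λ eq → e≢ (pos-unique (≡.subst (pair e ~_) (≡.sym eq) same))))) (zeroʳ _)
      ... | yes (inj₂ g) = trans (*-congˡ (trans (∂.cong (θ h) (K-sym _ _)) (∂K-otherEdge h g
        (λ eq → e≢ (pos-unique (≡.subst (pair e ~_) (≡.sym eq) swap)))))) (zeroʳ _)

    -- Restricted to edge positions, the row of `θ h` has the single nonzero entry `- s`. Only the
    -- edge rows are asked for because `kernel` applies this to a vector corrected by multiples of
    -- `f`, whose row `θₛ` is not known to vanish.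
    edges-independent : ∀ c → (∀ e → ¬ uncurry Adjacent (pair e) → c e ≈ 0#) →
      (∀ {i j} (h : i ⟶ j) → row (θ h) c ≈ 0#) → ∀ e → c e ≈ 0#
    edges-independent c supp rows e with uncurry (adjacent? G) (pair e)
    ... | no ¬adj      = supp e ¬adj
    ... | yes (inj₁ h) = ≡.subst (λ e → c e ≈ 0#) (≡.sym (pos-unique {e = e} same))
      (edge-coefficient-vanishes h supp (rows h))
    ... | yes (inj₂ h) = ≡.subst (λ e → c e ≈ 0#) (≡.sym (pos-unique {e = e} swap))
      (edge-coefficient-vanishes h supp (rows h))

    module _ {l l′ : Fin n} (l≢l′ : l ≢ l′) where

      -- Subtracting `c (pos l l)` times `f l` and `c (pos l′ l′)` times `f l′` clears both diagonal
      -- positions. By `row-f` the edge rows stay zero, so what is left is a relation on edges and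
      -- hence trivial. The second equation is the row of `s` applied to the resulting formula for
      -- `c`.
      kernel : ∀ c →
        (∀ e → ¬ uncurry Adjacent (pair e) → e ≢ pos l l → e ≢ pos l′ l′ → c e ≈ 0#) →
        (∀ t → row t c ≈ 0#) →
        (∀ e → c e ≈ c (pos l l) * f l e + c (pos l′ l′) * f l′ e) ×
        c (pos l l) * w l + c (pos l′ l′) * w l′ ≈ 0#
      kernel c supp rows = c≈ , (begin
          x * w l + y * w l′
            ≈⟨ +-cong (*-congˡ (row-fₛ l)) (*-congˡ (row-fₛ l′)) ⟨
          x * row θₛ (f l) + y * row θₛ (f l′)
            ≈⟨ row-combination θₛ x (f l) y (f l′) ⟨
          row θₛ (λ e → x * f l e + y * f l′ e)
            ≈⟨ row-cong θₛ c≈ ⟨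
          row θₛ c
            ≈⟨ rows θₛ ⟩
          0# ∎)
        where
        x = c (pos l l)
        y = c (pos l′ l′)
        g c′ : Fin (#positions n) → Carrier
        g e = (- x) * f l e + (- y) * f l′ e
        c′ e = c e + g e

        row-fₛ : ∀ l → row θₛ (f l) ≈ w l
        row-fₛ l = trans (row-f θₛ l) (trans (*-congˡ ∂ₛs) (*-identityʳ _))

        row-c′ : ∀ {i j} (h : i ⟶ j) → row (θ h) c′ ≈ 0#
        row-c′ h = begin
          row (θ h) c′
            ≈⟨ row-+ (θ h) c g ⟩
          row (θ h) c + row (θ h) g
            ≈⟨ +-cong (rows (θ h)) (row-combination (θ h) (- x) (f l) (- y) (f l′)) ⟩
          0# + ((- x) * row (θ h) (f l) + (- y) * row (θ h) (f l′))
            ≈⟨ +-congˡ (+-cong (vanish (- x) l) (vanish (- y) l′)) ⟩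
          0# + (0# + 0#)
            ≈⟨ trans (+-identityˡ _) (+-identityˡ _) ⟩
          0# ∎
          where
          vanish : ∀ x l → x * row (θ h) (f l) ≈ 0#
          vanish x l = trans (*-congˡ (trans (row-f (θ h) l) (trans (*-congˡ (∂s h)) (zeroʳ _)))) (zeroʳ x)

        c′-supp : ∀ e → ¬ uncurry Adjacent (pair e) → c′ e ≈ 0#
        c′-supp e ¬adj with e Fin.≟ pos l l | e Fin.≟ pos l′ l′
        ... | yes ≡.refl | _ = begin
          x + ((- x) * f l e + (- y) * f l′ e)
            ≈⟨ +-congˡ (+-cong (trans (*-congˡ (f-self l)) (*-identityʳ _))
                 (trans (*-congˡ (f-away (l≢l′ ∘ ≡.sym) (l≢l′ ∘ ≡.sym))) (zeroʳ _))) ⟩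
          x + (- x + 0#)
            ≈⟨ trans (+-congˡ (+-identityʳ _)) (-‿inverseʳ x) ⟩
          0# ∎
        ... | _ | yes ≡.refl = begin
          y + ((- x) * f l e + (- y) * f l′ e)
            ≈⟨ +-congˡ (+-cong (trans (*-congˡ (f-away l≢l′ l≢l′)) (zeroʳ _))
                 (trans (*-congˡ (f-self l′)) (*-identityʳ _))) ⟩
          y + (0# + - y)
            ≈⟨ trans (+-congˡ (+-identityˡ _)) (-‿inverseʳ y) ⟩
          0# ∎
        ... | no e≢ll | no e≢l′l′ = begin
          c e + ((- x) * f l e + (- y) * f l′ e)
            ≈⟨ +-cong (supp e ¬adj e≢ll e≢l′l′)
                 (+-cong (trans (*-congˡ (f≈0 e≢ll)) (zeroʳ _)) (trans (*-congˡ (f≈0 e≢l′l′)) (zeroʳ _))) ⟩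
          0# + (0# + 0#)
            ≈⟨ trans (+-identityˡ _) (+-identityˡ _) ⟩
          0# ∎
          where
          f≈0 : ∀ {l} → e ≢ pos l l → f l e ≈ 0#
          f≈0 {l} e≢ = f-vanishes l e λ
            { k (inj₁ ≡.refl) → e≢
            ; k (inj₂ h) ≡.refl → ¬adj (adjacent-~ (pair-pos l k) h) }
            where
            adjacent-~ : ∀ {p i j} → p ~ (i , j) → i ⟶ j → uncurry Adjacent p
            adjacent-~ same h = inj₁ h
            adjacent-~ swap h = inj₂ h

        c≈ : ∀ e → c e ≈ x * f l e + y * f l′ e
        c≈ e = begin
          c e
            ≈⟨ GroupProperties.inverseˡ-unique +-group (c e) (g e) (edges-independent c′ c′-supp row-c′ e) ⟩
          - ((- x) * f l e + (- y) * f l′ e)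
            ≈⟨ -‿+-comm _ _ ⟨
          - ((- x) * f l e) + - ((- y) * f l′ e)
            ≈⟨ +-cong (negate x (f l e)) (negate y (f l′ e)) ⟩
          x * f l e + y * f l′ e ∎
          where
          negate : ∀ x z → - ((- x) * z) ≈ x * z
          negate x z = trans (-‿distribˡ-* (- x) z) (*-congʳ (-‿involutive x))

  -- Dependent and independent sets of columns

  stars-dependent : ∀ {l l′} → l ≢ l′ → ¬ Independent (λ p → Star G l p ⊎ Star G l′ p)
  stars-dependent {l} {l′} l≢l′ ind = w≉0 l′ (begin
      w l′
        ≈⟨ trans (+-cong (trans (*-congˡ (f-self l)) (*-identityʳ _))
             (trans (*-congˡ (f-away (l≢l′ ∘ ≡.sym) (l≢l′ ∘ ≡.sym))) (zeroʳ _))) (+-identityʳ _) ⟨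
      c (pos l l)
        ≈⟨ ind c supp rows (pos l l) ⟩
      0# ∎)
    where
    c : Fin (#positions n) → Carrier
    -- The multiples of `ds` left by `f l` and `f l′` are `w l` and `w l′`; these cross factors
    -- cancel them. The coefficient at `pos l l` is then `w l′`, which is nonzero.
    c e = w l′ * f l e + (- w l) * f l′ e
    f≈0 : ∀ l e → ¬ Star G l (pair e) → f l e ≈ 0#
    f≈0 l e ∉l = f-vanishes l e λ { k k∈ ≡.refl → ∉l (k , k∈ , pair-pos l k) }
    supp : ∀ e → ¬ (Star G l (pair e) ⊎ Star G l′ (pair e)) → c e ≈ 0#
    supp e ∉ = trans (+-cong (trans (*-congˡ (f≈0 l e (∉ ∘ inj₁))) (zeroʳ _))
      (trans (*-congˡ (f≈0 l′ e (∉ ∘ inj₂))) (zeroʳ _))) (+-identityˡ 0#)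
    rows : ∀ t → row t c ≈ 0#
    rows t = begin
      row t c
        ≈⟨ row-combination t (w l′) (f l) (- w l) (f l′) ⟩
      w l′ * row t (f l) + (- w l) * row t (f l′)
        ≈⟨ +-cong (*-congˡ (row-f t l)) (trans (*-congˡ (row-f t l′)) (sym (-‿distribˡ-* _ _))) ⟩
      w l′ * (w l * ∂[ t ] s) + - (w l * (w l′ * ∂[ t ] s))
        ≈⟨ +-congʳ (solve 3 (λ a b c → a :* (b :* c) := b :* (a :* c)) refl (w l′) (w l) (∂[ t ] s)) ⟩
      w l * (w l′ * ∂[ t ] s) + - (w l * (w l′ * ∂[ t ] s))
        ≈⟨ -‿inverseʳ _ ⟩
      0# ∎

  -- By `kernel` a relation is x `f l` + y `f l′`. At the omitted position `f l′` is zero and `f l`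
  -- is 2 λ_lm, so x = 0, and then the equation in `w l` and `w l′` gives y = 0.
  stars-minus-edge-independent : ∀ {l l′ m} → l ⟶ m → l ≢ l′ → l′ ≢ m →
    Independent (λ p → (Star G l p ⊎ Star G l′ p) × ¬ p ~ (l , m))
  stars-minus-edge-independent {l} {l′} {m} h l≢l′ l′≢m c supp rows e = begin
      c e                                ≈⟨ proj₁ ker e ⟩
      x * f l e + y * f l′ e             ≈⟨ +-cong (trans (*-congʳ x≈0) (zeroˡ _)) (trans (*-congʳ y≈0) (zeroˡ _)) ⟩
      0# + 0#                            ≈⟨ +-identityˡ 0# ⟩
      0#                                 ∎
    where
    x = c (pos l l)
    y = c (pos l′ l′)
    star-adjacent : ∀ {l e} → e ≢ pos l l → Star G l (pair e) → uncurry Adjacent (pair e)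
    star-adjacent e≢ (k , inj₁ ≡.refl , r) = contradiction (pos-unique r) e≢
    star-adjacent {e = e} e≢ (k , inj₂ h , r) with pair e | r
    ... | _ | same = inj₁ h
    ... | _ | swap = inj₂ h
    ker = kernel l≢l′ c (λ e ¬adj e≢ll e≢l′l′ → supp e λ
      { (inj₁ ∈l , _)  → ¬adj (star-adjacent e≢ll ∈l)
      ; (inj₂ ∈l′ , _) → ¬adj (star-adjacent e≢l′l′ ∈l′) }) rows
    x≈0 : x ≈ 0#
    x≈0 = cancel (x+x≉0 (Λ≉0 h)) (begin
      x * (Λ l m + Λ l m)                          ≈⟨ *-congˡ (f-edge h) ⟨
      x * f l (pos l m)                            ≈⟨ +-identityʳ _ ⟨
      x * f l (pos l m) + 0#                       ≈⟨ +-congˡ (trans (*-congˡ (f-away (l≢l′ ∘ ≡.sym) l′≢m)) (zeroʳ y)) ⟨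
      x * f l (pos l m) + y * f l′ (pos l m)       ≈⟨ proj₁ ker (pos l m) ⟨
      c (pos l m)                                  ≈⟨ supp (pos l m) (λ (_ , ≁) → ≁ (pair-pos l m)) ⟩
      0#                                           ∎)
    y≈0 : y ≈ 0#
    y≈0 = cancel (w≉0 l′) (begin
      y * w l′                 ≈⟨ +-identityˡ _ ⟨
      0# + y * w l′            ≈⟨ +-congʳ (trans (*-congʳ x≈0) (zeroˡ _)) ⟨
      x * w l + y * w l′       ≈⟨ proj₂ ker ⟩
      0#                       ∎)

  edge-independent : ∀ {i j} → i ⟶ j → Independent (_~ (i , j))
  edge-independent {i} {j} h c supp rows = edges-independent c (λ e ¬adj → supp e (¬adj ∘ adjacent)) (λ h → rows (θ h))
    where
    adjacent : ∀ {p} → p ~ (i , j) → uncurry Adjacent p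
    adjacent same = inj₁ h
    adjacent swap = inj₂ h

  -- Every term of `K i j` is zero, so the column is zero and its unit vector is a relation.
  nonAdjacent-dependent : ∀ {i j} → i ≢ j → ¬ Adjacent i j → ¬ CommonChild G i j → ¬ Independent (_~ (i , j))
  nonAdjacent-dependent {i} {j} i≢j ¬adj childless ind = 1≉0 (trans (sym (I-self (pos i j)))
    (ind (I (pos i j)) (λ e ≁ → I-other (pos i j) e (λ { ≡.refl → ≁ (pair-pos i j) }))
      (λ t → trans (row-unit t i j) (trans (∂.cong t K≈0) (∂.0-homo t))) (pos i j)))
    where
    K≈0 : K i j ≈ 0#
    K≈0 = trans (K-nonAdjacent i≢j ¬adj) (trans (*-congˡ
      (sum-0 _ (λ k → ΛΛ-vanishes i j k (λ (h , h′) → childless (k , h , h′))))) (zeroʳ s))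

  -- A variable λ_mk occurs only in columns touching `m`, and (l , m) is the only such position in
  -- `Q`. Once K_lm depends on λ_mk, the row of that variable forces the coefficient at (l , m) to
  -- be zero. The third hypothesis supplies `k`: it is `l` itself if `m ⟶ l`, and otherwise a common
  -- child, where the derivative is s λ_lk.
  add-isolated : ∀ {l m} {Q : Fin n × Fin n → Set} → l ≢ m →
    (∀ {p} → Q p → m ≡ proj₁ p ⊎ m ≡ proj₂ p → p ~ (l , m)) →
    m ⟶ l ⊎ ¬ Adjacent l m × CommonChild G l m →
    Independent (λ p → Q p × ¬ p ~ (l , m)) → Independent Q
  add-isolated {l} {m} {Q} l≢m isolated link ind c supp rows =
    ind c (λ e ∉ → case e (e Fin.≟ pos l m) ∉) rows
    where
    others : ∀ {k} (h : m ⟶ k) e → e ≢ pos l m → c e * J (θ h) e ≈ 0#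
    others h e e≢ with m Fin.≟ proj₁ (pair e) | m Fin.≟ proj₂ (pair e)
    ... | yes eq | _      = trans (*-congʳ (supp e λ q → e≢ (pos-unique (isolated q (inj₁ eq))))) (zeroˡ _)
    ... | _      | yes eq = trans (*-congʳ (supp e λ q → e≢ (pos-unique (isolated q (inj₂ eq))))) (zeroˡ _)
    ... | no ≢₁  | no ≢₂  = trans (*-congˡ (∂K-vanishes (θ h) _ _ (∂s h) (other ≢₁) (other ≢₂))) (zeroʳ _)
      where
      other : ∀ {i} → m ≢ i → ∀ k → ∂[ θ h ] (Λ i k) ≈ 0#
      other {i} m≢i k = ∂Λ-other h i k (m≢i ∘ ≡.cong proj₁)

    ∂K≉0 : m ⟶ l ⊎ ¬ Adjacent l m × CommonChild G l m → ∃[ k ] ∃[ h ] ¬ ∂[ θ {m} {k} h ] (K l m) ≈ 0#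
    ∂K≉0 (inj₁ h) = l , h , λ e → -≉0 s≉0 (trans (sym (∂K-edge h)) (trans (∂.cong (θ h) (K-sym m l)) e))
    ∂K≉0 (inj₂ (¬adj , k , g , h)) = k , h , λ e → *-≉0 s≉0 (Λ≉0 g) (trans (sym derivative) e)
      where
      ∂Λl : ∀ j → ∂[ θ h ] (Λ l j) ≈ 0#
      ∂Λl j = ∂Λ-other h l j (l≢m ∘ ≡.sym ∘ ≡.cong proj₁)
      ∂ΛΛ : ∀ j → ∂[ θ h ] (Λ l j * Λ m j) ≈ Λ l j * ∂[ θ h ] (Λ m j)
      ∂ΛΛ j = trans (∂.leibniz (θ h) _ _) (trans (+-congʳ (trans (*-congʳ (∂Λl j)) (zeroˡ _))) (+-identityˡ _))
      derivative : ∂[ θ h ] (K l m) ≈ s * Λ l k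
      derivative = begin
        ∂[ θ h ] (K l m)
          ≈⟨ ∂.cong (θ h) (K-nonAdjacent l≢m ¬adj) ⟩
        ∂[ θ h ] (s * sum λ j → Λ l j * Λ m j)
          ≈⟨ ∂.leibniz (θ h) _ _ ⟩
        ∂[ θ h ] s * sum (λ j → Λ l j * Λ m j) + s * ∂[ θ h ] (sum λ j → Λ l j * Λ m j)
          ≈⟨ +-cong (trans (*-congʳ (∂s h)) (zeroˡ _)) (*-congˡ (begin
               ∂[ θ h ] (sum λ j → Λ l j * Λ m j)
                 ≈⟨ trans (∂.sum-homo (θ h) {n} _) (sum-cong-≋ ∂ΛΛ) ⟩
               sum (λ j → Λ l j * ∂[ θ h ] (Λ m j))
                 ≈⟨ sum-single k _ (λ j j≢k → trans (*-congˡ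
                      (∂Λ-other h m j (j≢k ∘ ≡.sym ∘ ≡.cong proj₂))) (zeroʳ _)) ⟩
               Λ l k * ∂[ θ h ] (Λ m k)
                 ≈⟨ trans (*-congˡ (∂Λ-self h)) (*-identityʳ _) ⟩
               Λ l k ∎)) ⟩
        0# + s * Λ l k
          ≈⟨ +-identityˡ _ ⟩
        s * Λ l k ∎

    c[lm]≈0 : c (pos l m) ≈ 0#
    c[lm]≈0 with ∂K≉0 link
    ... | k , h , ≉0 = coefficient-vanishes (θ h) l m ≉0 (others h) (rows (θ h))

    case : ∀ e → Dec (e ≡ pos l m) → ¬ (Q (pair e) × ¬ pair e ~ (l , m)) → c e ≈ 0#
    case e (yes ≡.refl) _ = c[lm]≈0
    case e (no e≢)      ∉ = supp e (λ q → ∉ (q , e≢ ∘ pos-unique))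

  private
    ∂-s* : ∀ t x → ∂[ t ] s ≈ 0# → ∂[ t ] (s * x) ≈ s * ∂[ t ] x
    ∂-s* t x ∂s≈0 = trans (∂.leibniz t s x) (trans (+-congʳ (trans (*-congʳ ∂s≈0) (zeroˡ x))) (+-identityˡ _))

    ∂ₛ-s* : ∀ x → ∂[ θₛ ] x ≈ 0# → ∂[ θₛ ] (s * x) ≈ x
    ∂ₛ-s* x ∂x≈0 = trans (∂.leibniz θₛ s x) (trans
      (+-cong (trans (*-congʳ ∂ₛs) (*-identityˡ x)) (trans (*-congˡ ∂x≈0) (zeroʳ s))) (+-identityʳ x))

    ∂[1+x²] : ∀ t x → ∂[ t ] (1# + x * x) ≈ ∂[ t ] (x * x)
    ∂[1+x²] t x = trans (∂.+-homo t 1# (x * x)) (trans (+-congʳ (∂.1-vanishes t)) (+-identityˡ _))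

  -- As `q` is the only child of both nodes, and they are not adjacent by triangle-freeness, the
  -- three entries involve only `s`, a = λ_mq and b = λ_lq: they are s (1 + a²), s (1 + b²) and s b
  -- a. This gives three rows for three unknown coefficients.
  collider-independent : ∀ {l m q} → l ≢ m → l ⟶ q → m ⟶ q →
    (∀ k → l ⟶ k → k ≡ q) → (∀ k → m ⟶ k → k ≡ q) →
    Independent (λ p → p ~ (m , m) ⊎ p ~ (l , l) ⊎ p ~ (l , m))
  collider-independent {l} {m} {q} l≢m h g only-l only-m c supp rows e =
      trans (c≈ e) (trans (+-cong (vanish x≈0) (+-cong (vanish y≈0) (vanish z≈0))) (trans (+-identityˡ _) (+-identityˡ _)))
    where
    x = c (pos m m)
    y = c (pos l l)
    z = c (pos l m)
    a = Λ m q
    b = Λ l q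

    vanish : ∀ {x u} → x ≈ 0# → x * u ≈ 0#
    vanish x≈0 = trans (*-congʳ x≈0) (zeroˡ _)

    distinct : ∀ {i j k l e} {A : Set} → pos i j ≡ e → pos k l ≡ e → ¬ (i , j) ~ (k , l) → A
    distinct eq eq′ ≁ = contradiction (pos-~ (≡.trans eq (≡.sym eq′))) ≁

    -- Unit vectors turn each row, a sum over all positions, into three terms.
    combination : Fin (#positions n) → Carrier
    combination e = x * I (pos m m) e + (y * I (pos l l) e + z * I (pos l m) e)

    c≈ : ∀ e → c e ≈ combination e
    c≈ e with pos m m Fin.≟ e | pos l l Fin.≟ e | pos l m Fin.≟ e
    ... | yes eq     | yes eq′    | _          = distinct eq eq′ λ { same → l≢m ≡.refl ; swap → l≢m ≡.refl }
    ... | yes eq     | _          | yes eq′    = distinct eq eq′ λ { same → l≢m ≡.refl ; swap → l≢m ≡.refl }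
    ... | _          | yes eq     | yes eq′    = distinct eq eq′ λ { same → l≢m ≡.refl ; swap → l≢m ≡.refl }
    ... | yes ≡.refl | no _       | no _       = solve 3 (λ x y z → x := x :* con 1 :+ (y :* con 0 :+ z :* con 0)) refl x y z
    ... | no _       | yes ≡.refl | no _       = solve 3 (λ x y z → y := x :* con 0 :+ (y :* con 1 :+ z :* con 0)) refl x y z
    ... | no _       | no _       | yes ≡.refl = solve 3 (λ x y z → z := x :* con 0 :+ (y :* con 0 :+ z :* con 1)) refl x y z
    ... | no ≢mm     | no ≢ll     | no ≢lm     = trans
      (supp e λ { (inj₁ r) → ≢mm (≡.sym (pos-unique r))
                ; (inj₂ (inj₁ r)) → ≢ll (≡.sym (pos-unique r))
                ; (inj₂ (inj₂ r)) → ≢lm (≡.sym (pos-unique r)) })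
      (solve 3 (λ x y z → con 0 := x :* con 0 :+ (y :* con 0 :+ z :* con 0)) refl x y z)

    K-mm : K m m ≈ s * (1# + a * a)
    K-mm = trans (K-diagonal m) (*-congˡ (+-congˡ (sum-single q _ λ k k≢q →
      ΛΛ-vanishes m m k (λ (h , _) → k≢q (only-m k h)))))

    K-ll : K l l ≈ s * (1# + b * b)
    K-ll = trans (K-diagonal l) (*-congˡ (+-congˡ (sum-single q _ λ k k≢q →
      ΛΛ-vanishes l l k (λ (h , _) → k≢q (only-l k h)))))

    K-lm : K l m ≈ s * (b * a)
    K-lm = trans (K-nonAdjacent l≢m (λ adj → triangleFree l m q (h , g , adj)))
      (*-congˡ (sum-single q _ λ k k≢q → ΛΛ-vanishes l m k (λ (h , _) → k≢q (only-l k h))))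

    ∂ₘb : ∂[ θ g ] b ≈ 0#
    ∂ₘb = ∂Λ-other g l q (l≢m ∘ ≡.sym ∘ ≡.cong proj₁)

    ∂ₗa : ∂[ θ h ] a ≈ 0#
    ∂ₗa = ∂Λ-other h m q (l≢m ∘ ≡.cong proj₁)

    equation : ∀ t {u v w} → ∂[ t ] (K m m) ≈ u → ∂[ t ] (K l l) ≈ v → ∂[ t ] (K l m) ≈ w →
      x * u + (y * v + z * w) ≈ 0#
    equation t {u} {v} {w} eᵤ eᵥ e_w = begin
      x * u + (y * v + z * w)
        ≈⟨ +-cong (*-congˡ (trans (row-unit t m m) eᵤ))
             (+-cong (*-congˡ (trans (row-unit t l l) eᵥ)) (*-congˡ (trans (row-unit t l m) e_w))) ⟨
      x * row t (I (pos m m)) + (y * row t (I (pos l l)) + z * row t (I (pos l m)))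
        ≈⟨ +-cong (row-* t x (I (pos m m))) (row-combination t y (I (pos l l)) z (I (pos l m))) ⟨
      row t (λ e → x * I (pos m m) e) + row t (λ e → y * I (pos l l) e + z * I (pos l m) e)
        ≈⟨ row-+ t (λ e → x * I (pos m m) e) (λ e → y * I (pos l l) e + z * I (pos l m) e) ⟨
      row t combination
        ≈⟨ row-cong t c≈ ⟨
      row t c
        ≈⟨ rows t ⟩
      0# ∎

    -- The row of a, divided by `s`. K_ll does not involve a, which is why `y` is absent; `eqₗ` is
    -- the mirror image with b.
    eqₘ : (a + a) * x + b * z ≈ 0#
    eqₘ = cancel s≉0 (trans (solve 5 (λ a b s x z →
        ((a :+ a) :* x :+ b :* z) :* s := x :* (s :* (a :+ a)) :+ (con 0 :+ z :* (s :* b))) refl a b s x z)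
      (trans (+-congˡ (+-congʳ (sym (zeroʳ y)))) (equation (θ g)
        (trans (∂.cong (θ g) K-mm) (trans (∂-s* (θ g) _ (∂s g)) (*-congˡ (trans (∂[1+x²] (θ g) a) (∂Λ² g)))))
        (trans (∂.cong (θ g) K-ll) (trans (∂-s* (θ g) _ (∂s g)) (trans (*-congˡ
          (trans (∂[1+x²] (θ g) b) (∂.*-vanishes (θ g) ∂ₘb ∂ₘb))) (zeroʳ s))))
        (trans (∂.cong (θ g) K-lm) (trans (∂-s* (θ g) _ (∂s g)) (*-congˡ (trans (∂.leibniz (θ g) b a)
          (trans (+-cong (vanish ∂ₘb) (trans (*-congˡ (∂Λ-self g)) (*-identityʳ b))) (+-identityˡ b)))))))))

    eqₗ : (b + b) * y + a * z ≈ 0#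
    eqₗ = cancel s≉0 (trans (solve 5 (λ a b s y z →
        ((b :+ b) :* y :+ a :* z) :* s := con 0 :+ (y :* (s :* (b :+ b)) :+ z :* (s :* a))) refl a b s y z)
      (trans (+-congʳ (sym (zeroʳ x))) (equation (θ h)
        (trans (∂.cong (θ h) K-mm) (trans (∂-s* (θ h) _ (∂s h)) (trans (*-congˡ
          (trans (∂[1+x²] (θ h) a) (∂.*-vanishes (θ h) ∂ₗa ∂ₗa))) (zeroʳ s))))
        (trans (∂.cong (θ h) K-ll) (trans (∂-s* (θ h) _ (∂s h)) (*-congˡ (trans (∂[1+x²] (θ h) b) (∂Λ² h)))))
        (trans (∂.cong (θ h) K-lm) (trans (∂-s* (θ h) _ (∂s h)) (*-congˡ (trans (∂.leibniz (θ h) b a)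
          (trans (+-cong (trans (*-congʳ (∂Λ-self h)) (*-identityˡ a)) (trans (*-congˡ ∂ₗa) (zeroʳ b))) (+-identityʳ a)))))))))

    eqₛ : x * (1# + a * a) + (y * (1# + b * b) + z * (b * a)) ≈ 0#
    eqₛ = equation θₛ
      (trans (∂.cong θₛ K-mm) (∂ₛ-s* _ (trans (∂[1+x²] θₛ a) (∂.*-vanishes θₛ (∂ₛΛ m q) (∂ₛΛ m q)))))
      (trans (∂.cong θₛ K-ll) (∂ₛ-s* _ (trans (∂[1+x²] θₛ b) (∂.*-vanishes θₛ (∂ₛΛ l q) (∂ₛΛ l q)))))
      (trans (∂.cong θₛ K-lm) (∂ₛ-s* _ (∂.*-vanishes θₛ (∂ₛΛ l q) (∂ₛΛ m q))))

    -- Differentiating by a leaves 2a, so positivity of real squares does not enter.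
    a²+b²≉0 : ¬ a * a + b * b ≈ 0#
    a²+b²≉0 e = x+x≉0 (Λ≉0 g) (begin
      a + a                                         ≈⟨ +-identityʳ _ ⟨
      (a + a) + 0#                                  ≈⟨ +-cong (∂Λ² g) (∂.*-vanishes (θ g) ∂ₘb ∂ₘb) ⟨
      ∂[ θ g ] (a * a) + ∂[ θ g ] (b * b)           ≈⟨ ∂.+-homo (θ g) _ _ ⟨
      ∂[ θ g ] (a * a + b * b)                      ≈⟨ trans (∂.cong (θ g) e) (∂.0-homo (θ g)) ⟩
      0#                                            ∎)

    -- Eliminating x and y from the three equations leaves (a² + b²) z.
    z≈0 : z ≈ 0#
    z≈0 = cancel a²+b²≉0 (begin
      z * (a * a + b * b)
        ≈⟨ trans (+-congʳ (trans (*-congˡ eqₛ) (zeroʳ _))) (+-identityˡ _) ⟨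
      (a + a) * b * (x * (1# + a * a) + (y * (1# + b * b) + z * (b * a))) + z * (a * a + b * b)
        ≈⟨ solve 5 (λ a b x y z →
             (a :+ a) :* b :* (x :* (con 1 :+ a :* a) :+ (y :* (con 1 :+ b :* b) :+ z :* (b :* a))) :+ z :* (a :* a :+ b :* b) :=
             b :* (con 1 :+ a :* a) :* ((a :+ a) :* x :+ b :* z) :+ a :* (con 1 :+ b :* b) :* ((b :+ b) :* y :+ a :* z)) refl a b x y z ⟩
      b * (1# + a * a) * ((a + a) * x + b * z) + a * (1# + b * b) * ((b + b) * y + a * z)
        ≈⟨ +-cong (trans (*-congˡ eqₘ) (zeroʳ _)) (trans (*-congˡ eqₗ) (zeroʳ _)) ⟩
      0# + 0#
        ≈⟨ +-identityˡ 0# ⟩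
      0# ∎)

    x≈0 : x ≈ 0#
    x≈0 = cancel (x+x≉0 (Λ≉0 g)) (begin
      x * (a + a)               ≈⟨ *-comm x _ ⟩
      (a + a) * x               ≈⟨ trans (+-congˡ (trans (*-congˡ z≈0) (zeroʳ b))) (+-identityʳ _) ⟨
      (a + a) * x + b * z       ≈⟨ eqₘ ⟩
      0#                        ∎)

    y≈0 : y ≈ 0#
    y≈0 = cancel (x+x≉0 (Λ≉0 h)) (begin
      y * (b + b)               ≈⟨ *-comm y _ ⟩
      (b + b) * y               ≈⟨ trans (+-congˡ (trans (*-congˡ z≈0) (zeroʳ a))) (+-identityʳ _) ⟨
      (b + b) * y + a * z       ≈⟨ eqₗ ⟩
      0#                        ∎)

-- Comparison of two graphs

_~?_ : ∀ {n} (p q : Fin n × Fin n) → Dec (p ~ q)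
(i , j) ~? (k , l) = map′
  (λ { (inj₁ (≡.refl , ≡.refl)) → same ; (inj₂ (≡.refl , ≡.refl)) → swap })
  (λ { same → inj₁ (≡.refl , ≡.refl) ; swap → inj₂ (≡.refl , ≡.refl) })
  (((i Fin.≟ k) ×-dec (j Fin.≟ l)) ⊎-dec ((i Fin.≟ l) ×-dec (j Fin.≟ k)))

Star? : ∀ {n} (G : Digraph n) l → Decidable (Star G l)
Star? G l p = Fin.any? λ k → ((k Fin.≟ l) ⊎-dec edge? G l k) ×-dec (p ~? (l , k))

module _ {m : ℕ} {P : Fin m → Set} (P? : Decidable P) where

  subset : Subset m
  subset = Vec.tabulate (does ∘ P?)

  ∈-subset⁺ : ∀ {e} → P e → e ∈ subset
  ∈-subset⁺ {e} p = lookup⇒[]= e subset (≡.trans (lookup∘tabulate (does ∘ P?) e) (dec-true (P? e) p))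

  ∈-subset⁻ : ∀ {e} → e ∈ subset → P e
  ∈-subset⁻ {e} e∈ = does⇒ (P? e) (≡.trans (≡.sym (lookup∘tabulate (does ∘ P?) e)) ([]=⇒lookup e∈))
    where
    does⇒ : ∀ {A : Set} (A? : Dec A) → does A? ≡ true → A
    does⇒ (yes a) _ = a

module Matroid {n : ℕ} (G : Digraph n)
  (simple : Digraph.Simple G) (triangleFree : Digraph.TransitiveTriangleFree G) where
  open Positions n
  open Columns G (coordinates G) simple triangleFree public

  -- Combines the clearing of denominators with the passage from subsets to predicates. Decidability
  -- is what turns a predicate into a `Subset`.
  JacobianMatroid⇔Independent : ∀ {Q} (Q? : Decidable Q) →
    JacobianMatroid G (subset (Q? ∘ pair)) ⇔ Independent Q
  JacobianMatroid⇔Independent {Q} Q? = mk⇔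
    (λ ind c supp → to ind c (λ e e∉ → supp e (e∉ ∘ ∈-subset⁺ (Q? ∘ pair))))
    (λ ind → from (λ c supp → ind c (λ e ¬q → supp e (¬q ∘ ∈-subset⁻ (Q? ∘ pair)))))
    where
    open Equivalence (fractions-independent⇔ (Coordinates.domain (coordinates G)) J (subset (Q? ∘ pair)))

SameMatroid-sym : ∀ {m} {M N : Subset m → Set} → SameMatroid M N → SameMatroid N M
SameMatroid-sym M≡N S = ⇔-sym (M≡N S)

module Comparison {n : ℕ} (G H : Digraph n)
  (simpleG : Digraph.Simple G) (simpleH : Digraph.Simple H)
  (triangleFreeG : Digraph.TransitiveTriangleFree G) (triangleFreeH : Digraph.TransitiveTriangleFree H)
  (same-matroid : SameMatroid (JacobianMatroid G) (JacobianMatroid H)) where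

  private
    module G where
      open Digraph G public
      open Matroid G simpleG triangleFreeG public
    module H where
      open Digraph H public
      open Matroid H simpleH triangleFreeH public
    open Positions n

  transfer : ∀ {Q} → Decidable Q → G.Independent Q ⇔ H.Independent Q
  transfer Q? = mk⇔
    (λ ind → H⇔.to (S⇔.to (G⇔.from ind)))
    (λ ind → G⇔.to (S⇔.from (H⇔.from ind)))
    where
    module G⇔ = Equivalence (G.JacobianMatroid⇔Independent Q?)
    module H⇔ = Equivalence (H.JacobianMatroid⇔Independent Q?)
    module S⇔ = Equivalence (same-matroid (subset (Q? ∘ pair)))

  module _ {Q : Fin n × Fin n → Set} (Q? : Decidable Q) where
    open Equivalence (transfer Q?) public renaming (to to G⇒H; from to H⇒G)

  -- The position of an edge is not a loop of the matroid of `G`, whereas a nonadjacent pair without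
  -- a common child is a loop of that of `H`.
  edge⇒linked : ∀ {l m} → l G.⟶ m → H.Adjacent l m ⊎ CommonChild H l m
  edge⇒linked {l} {m} h with adjacent? H l m | Fin.any? (λ k → edge? H l k ×-dec edge? H m k)
  ... | yes adj | _          = inj₁ adj
  ... | no _    | yes common = inj₂ common
  ... | no ¬adj | no ¬common = contradiction
    (G⇒H (_~? (l , m)) (G.edge-independent h)) (H.nonAdjacent-dependent (⟶⇒≢ G h) ¬adj ¬common)

  -- Without l′ ⟶ m in G, column (l , m) would be the only one in the stars of l and l′ to
  -- meet m, so H could not put it on a circuit with the others.
  unshared-edge⇒star : ∀ {l m l′} → l G.⟶ m → ¬ l H.⟶ m → l ≢ l′ → l′ ≢ m → l′ G.⟶ m
  unshared-edge⇒star {l} {m} {l′} h ¬h l≢l′ l′≢m = decidable-stable (edge? G l′ m) λ ¬h′ →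
    G.stars-dependent l≢l′ (H⇒G stars? (H.add-isolated (⟶⇒≢ G h) (isolated ¬h′) link
      (G⇒H (λ p → stars? p ×-dec ¬? (p ~? (l , m))) (G.stars-minus-edge-independent h l≢l′ l′≢m))))
    where
    stars? : Decidable (λ p → Star G l p ⊎ Star G l′ p)
    stars? p = Star? G l p ⊎-dec Star? G l′ p

    link : m H.⟶ l ⊎ ¬ H.Adjacent l m × CommonChild H l m
    link with adjacent? H l m | edge⇒linked h
    ... | yes (inj₁ g) | _           = contradiction g ¬h
    ... | yes (inj₂ g) | _           = inj₁ g
    ... | no ¬adj      | inj₁ adj    = contradiction adj ¬adj
    ... | no ¬adj      | inj₂ common = inj₂ (¬adj , common)

    other-end : ∀ {p l k} → p ~ (l , k) → m ≡ proj₁ p ⊎ m ≡ proj₂ p → l ≢ m → k ≡ m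
    other-end same (inj₁ ≡.refl) l≢m = contradiction ≡.refl l≢m
    other-end same (inj₂ ≡.refl) l≢m = ≡.refl
    other-end swap (inj₁ ≡.refl) l≢m = ≡.refl
    other-end swap (inj₂ ≡.refl) l≢m = contradiction ≡.refl l≢m

    isolated : ¬ l′ G.⟶ m → ∀ {p} → Star G l p ⊎ Star G l′ p → m ≡ proj₁ p ⊎ m ≡ proj₂ p → p ~ (l , m)
    isolated ¬h′ (inj₁ (k , _ , r)) m∈ with other-end r m∈ (⟶⇒≢ G h)
    ... | ≡.refl = r
    isolated ¬h′ (inj₂ (k , k∈ , r)) m∈ with other-end r m∈ l′≢m | k∈
    ... | ≡.refl | inj₁ eq = contradiction (≡.sym eq) l′≢m
    ... | ≡.refl | inj₂ h′ = contradiction h′ ¬h′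

  module _ {l m : Fin n} (h : l G.⟶ m) (¬h : ¬ l H.⟶ m) where

    all-to-m : ∀ {i} → i ≢ m → i G.⟶ m
    all-to-m {i} i≢m with l Fin.≟ i
    ... | yes ≡.refl = h
    ... | no l≢i     = unshared-edge⇒star h ¬h l≢i i≢m

    -- If `k` differs from `m`, then `k ⟶ m` by `all-to-m`. For `i` equal to `m` this reverses the
    -- given edge; otherwise `i ⟶ m` as well, and `i`, `k`, `m` form a transitive triangle.
    only-to-m : ∀ i k → i G.⟶ k → k ≡ m
    only-to-m i k g = decidable-stable (k Fin.≟ m) λ k≢m → case k≢m (i Fin.≟ m)
      where
      case : k ≢ m → ¬ Dec (i ≡ m)
      case k≢m (yes ≡.refl) = simpleG i k (g , all-to-m k≢m)
      case k≢m (no i≢m)     = triangleFreeG i k m (all-to-m i≢m , all-to-m k≢m , inj₁ g)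

-- Contradiction from an edge of one graph that the other lacks

module SharedMatroid {n : ℕ} (G H : Digraph n)
  (simpleG : Digraph.Simple G) (simpleH : Digraph.Simple H)
  (triangleFreeG : Digraph.TransitiveTriangleFree G) (triangleFreeH : Digraph.TransitiveTriangleFree H)
  (same-matroid : SameMatroid (JacobianMatroid G) (JacobianMatroid H)) where

  open Digraph G using () renaming (_⟶_ to _⟶ᴳ_)
  open Digraph H using () renaming (_⟶_ to _⟶ᴴ_)
  private
    module GH = Comparison G H simpleG simpleH triangleFreeG triangleFreeH same-matroid
    module HG = Comparison H G simpleH simpleG triangleFreeH triangleFreeG (SameMatroid-sym same-matroid)
    module MG = Matroid G simpleG triangleFreeG
    module MH = Matroid H simpleH triangleFreeH

  private
    -- By `edge⇒linked`, `H` has the edge `m` to `l` or a common child of `l` and `m`. Either way,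
    -- inside `G` this is an edge leaving `m`, although all edges of `G` end in `m`.
    ¬contained : ∀ {l m} → l ⟶ᴳ m → ¬ l ⟶ᴴ m → ¬ (∀ i j → i ⟶ᴴ j → i ⟶ᴳ j)
    ¬contained {l} {m} h ¬h H⊆G with GH.edge⇒linked h
    ... | inj₁ (inj₁ g) = ¬h g
    ... | inj₁ (inj₂ g) = ⟶⇒≢ G h (GH.only-to-m h ¬h m l (H⊆G m l g))
    ... | inj₂ (k , g , g′) = ⟶⇒≢ G (H⊆G m k g′) (≡.sym (GH.only-to-m h ¬h l k (H⊆G l k g)))

    -- In `G` the node `m` has no children and `r` has at most the child `m`, so the stars of `m`
    -- and `r` lie in the positions mm, rr, rm. In `H` both nodes have `q` as their only child,
    -- which makes these positions independent.
    ¬distinct-stars : ∀ {l m p q r} → l ⟶ᴳ m → ¬ l ⟶ᴴ m → p ⟶ᴴ q → ¬ p ⟶ᴳ q → r ≢ m → r ≢ q → ¬ m ≢ q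
    ¬distinct-stars {l} {m} {p} {q} {r} h ¬h g ¬g r≢m r≢q m≢q =
      MG.stars-dependent {m} {r} (r≢m ∘ ≡.sym) (GH.H⇒G (λ p → Star? G m p ⊎-dec Star? G r p)
        (λ c supp → MH.collider-independent r≢m (HG.all-to-m g ¬g r≢q) (HG.all-to-m g ¬g m≢q)
          (HG.only-to-m g ¬g r) (HG.only-to-m g ¬g m) c (λ e ∉ → supp e (∉ ∘ ⊆))))
      where
      ⊆ : ∀ {p} → Star G m p ⊎ Star G r p → p ~ (m , m) ⊎ p ~ (r , r) ⊎ p ~ (r , m)
      ⊆ (inj₁ (k , inj₁ ≡.refl , e)) = inj₁ e
      ⊆ (inj₁ (k , inj₂ m⟶k , e))    = contradiction (≡.sym (GH.only-to-m h ¬h m k m⟶k)) (⟶⇒≢ G m⟶k)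
      ⊆ (inj₂ (k , inj₁ ≡.refl , e)) = inj₂ (inj₁ e)
      ⊆ (inj₂ (k , inj₂ r⟶k , e)) with GH.only-to-m h ¬h r k r⟶k
      ... | ≡.refl = inj₂ (inj₂ e)

  edge-transfers : ¬ Digraph.Complete G → ∀ {l m} → l ⟶ᴳ m → l ⟶ᴴ m
  edge-transfers incomplete {l} {m} h = decidable-stable (edge? H l m) λ ¬h →
    -- Either `H` also has an edge that `G` lacks, and then the shape theorem holds for `H` with its
    -- own center `q`, or `H` lies in `G`.
    case ¬h (Fin.any? λ p → Fin.any? λ q → edge? H p q ×-dec ¬? (edge? G p q))
    where
    case : ¬ l ⟶ᴴ m → ¬ Dec (∃[ p ] ∃[ q ] p ⟶ᴴ q × ¬ p ⟶ᴳ q)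
    case ¬h (no none) = ¬contained h ¬h (λ i j g → decidable-stable (edge? G i j) (λ ¬g → none (i , j , g , ¬g)))
    case ¬h (yes (p , q , g , ¬g)) = third (Fin.any? λ r → ¬? (r Fin.≟ m) ×-dec ¬? (r Fin.≟ q))
      where
      m≢q : m ≢ q
      -- With equal centers, `G` would contain the edge from `p` to `q` that it was assumed to lack.
      m≢q ≡.refl = ¬g (GH.all-to-m h ¬h (⟶⇒≢ H g))
      third : ¬ Dec (∃[ r ] r ≢ m × r ≢ q)
      third (yes (r , r≢m , r≢q)) = ¬distinct-stars h ¬h g ¬g r≢m r≢q m≢q
      third (no none) = incomplete complete
        where
        -- Without a third node only `m` and `q` exist, and `G` joins every other node to `m`.
        complete : Digraph.Complete G
        complete i j i≢j with i Fin.≟ m | j Fin.≟ m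
        ... | no i≢m     | yes ≡.refl = inj₁ (GH.all-to-m h ¬h i≢m)
        ... | yes ≡.refl | no j≢m     = inj₂ (GH.all-to-m h ¬h j≢m)
        ... | yes i≡m    | yes j≡m    = contradiction (≡.trans i≡m (≡.sym j≡m)) i≢j
        ... | no i≢m     | no j≢m     = contradiction (≡.trans (≡q i≢m) (≡.sym (≡q j≢m))) i≢j
          where
          ≡q : ∀ {r} → r ≢ m → r ≡ q
          ≡q {r} r≢m = decidable-stable (r Fin.≟ q) (λ r≢q → none (r , r≢m , r≢q))

T-ext : ∀ {a b} → (T a → T b) → (T b → T a) → a ≡ b
T-ext {true}  {true}  _ _ = ≡.refl
T-ext {true}  {false} f _ = contradiction (f _) (λ ())
T-ext {false} {true}  _ g = contradiction (g _) (λ ())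
T-ext {false} {false} _ _ = ≡.refl

theorem4p8 : (n : ℕ) (G₁ G₂ : Digraph n) →
    Digraph.Simple G₁ → Digraph.Simple G₂ →
    ¬ (G₁ ≐ G₂) →
    ¬ Digraph.Complete G₁ → ¬ Digraph.Complete G₂ →
    Digraph.TransitiveTriangleFree G₁ → Digraph.TransitiveTriangleFree G₂ →
    ¬ SameMatroid (JacobianMatroid G₁) (JacobianMatroid G₂)
theorem4p8 n G₁ G₂ simple₁ simple₂ G₁≢G₂ incomplete₁ incomplete₂ free₁ free₂ same-matroid =
  G₁≢G₂ λ i j → T-ext
    (SharedMatroid.edge-transfers G₁ G₂ simple₁ simple₂ free₁ free₂ same-matroid incomplete₁)
    (SharedMatroid.edge-transfers G₂ G₁ simple₂ simple₁ free₂ free₁ (SameMatroid-sym same-matroid) incomplete₂)
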